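{- Let $U$ be a $\kappa$-cut that is not $(\mathrm{I},\kappa-1)$-small, is not equal to $C(i,j)=C_i\cup T\cup C_j$ for any wheel $(T;C_1,\dots,C_w)$ and indices $i\ne j$, and has a side $A$ with $|A|>2\kappa$. Consider the family $\mathcal L$ of $\kappa$-cuts $W\neq U$ with $W\subseteq U\cup A$ that are not $(\mathrm{I},\kappa-1)$-small; for $W\in\mathcal L$ let $S(W)$ be the side of $W$ containing $U\setminus W$ and all sides of $U$ other than $A$, and let $R(W)$ be the union of all other sides of $W$. Call $W\in\mathcal L$ maximal if there is no $W'\in\mathcal L$, $W'\neq W$, with $R(W)\subseteq R(W')$. 1. If matching cuts of $U$ in side $A$ exist, let $Q=\bigcup_{P\in\Theta^*}P$ and $X=(U\setminus Q)\cup\mathrm{Match}_{U;A}(Q)$. Then every $W\in\mathcal L$ is (i) a laminar cut of $X$ within the region $A\setminus\mathrm{Match}_{U;A}(Q)$ (i.e. $W\subseteq X\cup(A\setminus \mathrm{Match}_{U;A}(Q))$), or (ii) a matching cut of $U$ (in side $A$), or (iii) a crossing matching cut of $X$. 2. If there are no matching cuts of $U$ in side $A$, then every $W\in\mathcal L$ is either maximal or is a laminar cut of some maximal $W_i\in\mathcal L$ in a side of $W_i$ contained in $R(W_i)$; moreover, for any two distinct maximal $W_i,W_j\in\mathcal L$, $R(W_i)\cap R(W_j)=\emptyset$.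
   Context: Standing conventions: $G=(V,E)$ is a finite, simple, connected, undirected, non-complete graph with $n=|V|$; $\kappa$ is its vertex connectivity, assumed $\kappa<n/4$. A cut is a set $U\subset V$ whose removal disconnects $G$; a $\kappa$-cut is a cut of size $\kappa$; a side of $U$ is a connected component of the subgraph induced on $V\setminus U$. A laminar cut of $U$ in side $P$ is a cut $W\subseteq U\cup P$. A cut with sides $A_1,\dots,A_a$ is $(\mathrm{I},t)$-small if $\sum_{i\ne i^\sharp}|A_i|\le t$ for some index $i^\sharp$. Wheels: for $w\ge4$ (indices modulo $w$), if $V$ is partitioned into pairwise disjoint sets $T,C_1,\dots,C_w,S_1,\dots,S_w$ with all $C_i,S_i$ nonempty ($T$ may be empty) such that for every $i$, $C_i\cup T\cup C_{i+2}$ is a $\kappa$-cut disconnecting $S_i\cup C_{i+1}\cup S_{i+1}$ from the rest of the graph (i.e. every path from that set to the remaining vertices outside the cut meets the cut), then $(T;C_1,\dots,C_w)$ forms a $w$-wheel. Matching cuts: for a cut $U$, a side $A$ of $U$, and $P\subseteq U$, a $\kappa$-cut $W$ is a matching cut of $U$ in side $A$ w.r.t. $P$ if (i) $U\setminus P\subseteq W\subseteq U\cup A$, (ii) $A\setminus W\neq\emptyset$, (iii) $P\cup(V\setminus(U\cup A))$ and $A\setminus W$ are disjoint from $W$ and every path between them meets $W$; then $\mathrm{Match}_{U;A}(P)=W\setminus U$. If a cut $Y$ has exactly two sides $A',B'$ and $\emptyset\ne P\subseteq Y$, a $\kappa$-cut $W$ is a crossing matching cut of $Y$ in side $A'$ w.r.t.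 $P$ if $W\cap B'\ne\emptyset$ and $(Y\setminus P)\cup(W\cap A')$ is a matching cut of $Y$ in side $A'$ w.r.t. $P$; "a crossing matching cut of $Y$" means one in some side w.r.t. some such $P$. $\Theta=\{P\subseteq U:\text{a matching cut of }U\text{ in side }A\text{ w.r.t. }P\text{ exists}\}$, $\Theta^*=\{\bigcap\{P\in\Theta:u\in P\}: u\in U\text{ lies in some member of }\Theta\}$. -}

module Defs where

open import Data.Fin.Base using (Fin; toℕ)
open import Data.Fin.Subset using (Subset; _∈_; _∉_; _⊆_; _∩_; _∪_; _─_; ∁; ∣_∣; Nonempty; Empty)
open import Data.List.Base using (List; map; removeAt; sum)
import Data.List.Membership.Propositional as List
open import Data.List.Relation.Unary.Unique.Propositional using (Unique)
open import Data.Nat.Base using (ℕ; suc; _+_; _∸_; _≤_)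
open import Data.Nat.DivMod using (_mod_)
open import Data.Product.Base using (∃-syntax; _×_)
open import Data.Sum.Base using (_⊎_)
open import Function.Bundles using (_⇔_)
open import Level using (0ℓ)
open import Relation.Binary.Construct.Closure.ReflexiveTransitive using (Star)
open import Relation.Binary.Core using (Rel)
open import Relation.Binary.Definitions using (Decidable; Irreflexive; Symmetric)
open import Relation.Binary.PropositionalEquality.Core using (_≡_; _≢_)
open import Relation.Nullary.Negation.Core using (¬_)
open import Relation.Unary using (Pred)

record Graph (n : ℕ) : Set₁ where
  field
    Edge   : Rel (Fin n) 0ℓ
    edge?  : Decidable Edge
    sym    : Symmetric Edge
    irrefl : Irreflexive _≡_ Edge

Disjoint : ∀ {n} → Subset n → Subset n → Set
Disjoint p q = Empty (p ∩ q)

infixl 6 _⊕_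

-- i + k modulo w
_⊕_ : ∀ {w} → Fin w → ℕ → Fin w
_⊕_ {suc w} i k = (toℕ i + k) mod (suc w)

module _ {n : ℕ} (G : Graph n) where
  open Graph G

  Connected : Set
  Connected = ∀ x y → Star Edge x y

  NonComplete : Set
  NonComplete = ∃[ x ] ∃[ y ] x ≢ y × ¬ Edge x y

  -- There is a path from x to y, endpoints included, that does not meet U.
  Path-avoiding : Subset n → Rel (Fin n) 0ℓ
  Path-avoiding U x y = x ∉ U × Star (λ a b → Edge a b × b ∉ U) x y

  -- Every path between a vertex of X and a vertex of Y meets W.
  Separates : (W X Y : Subset n) → Set
  Separates W X Y = ∀ {x y} → x ∈ X → y ∈ Y → ¬ Path-avoiding W x y

  IsCut : Subset n → Set
  IsCut U = ∃[ x ] ∃[ y ] x ∉ U × y ∉ U × ¬ Path-avoiding U x y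

  IsSide : (U A : Subset n) → Set
  IsSide U A = ∃[ x ] x ∉ U × (∀ y → y ∈ A ⇔ Path-avoiding U x y)

  -- For a non-complete graph, the vertex connectivity is the least size of a cut.
  IsVertexConnectivity : ℕ → Set
  IsVertexConnectivity κ = (∃[ U ] IsCut U × ∣ U ∣ ≡ κ) × (∀ U → IsCut U → κ ≤ ∣ U ∣)

  IsLaminarCut : (U P W : Subset n) → Set
  IsLaminarCut U P W = IsSide U P × IsCut W × W ⊆ U ∪ P

  -- As lists the sides of U without repetition.
  EnumeratesSides : Subset n → List (Subset n) → Set
  EnumeratesSides U As = Unique As × (∀ A → A List.∈ As ⇔ IsSide U A)

  -- (I,t)-small
  IsSmall : ℕ → Subset n → Set
  IsSmall t U = ∃[ As ] EnumeratesSides U As ×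
    ∃[ i♯ ] sum (map ∣_∣ (removeAt As i♯)) ≤ t

  HasExactlyTwoSides : (Y A B : Subset n) → Set
  HasExactlyTwoSides Y A B =
    IsSide Y A × IsSide Y B × A ≢ B × (∀ D → IsSide Y D → D ≡ A ⊎ D ≡ B)

  module _ (κ : ℕ) where

    IsκCut : Subset n → Set
    IsκCut U = IsCut U × ∣ U ∣ ≡ κ

    record IsWheel {w : ℕ} (T : Subset n) (C S : Fin w → Subset n) : Set where
      field
        4≤w          : 4 ≤ w
        cover        : ∀ v → v ∈ T ⊎ (∃[ i ] v ∈ C i) ⊎ (∃[ i ] v ∈ S i)
        T-C-disjoint : ∀ i → Disjoint T (C i)
        T-S-disjoint : ∀ i → Disjoint T (S i)
        C-S-disjoint : ∀ i j → Disjoint (C i) (S j)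
        C-disjoint   : ∀ {i j} → i ≢ j → Disjoint (C i) (C j)
        S-disjoint   : ∀ {i j} → i ≢ j → Disjoint (S i) (S j)
        C-nonempty   : ∀ i → Nonempty (C i)
        S-nonempty   : ∀ i → Nonempty (S i)
        κ-cut        : ∀ i → IsκCut (C i ∪ T ∪ C (i ⊕ 2))
        disconnects  : ∀ i →
          let cut  = C i ∪ T ∪ C (i ⊕ 2)
              part = S i ∪ C (i ⊕ 1) ∪ S (i ⊕ 1)
          in Separates cut part (∁ (cut ∪ part))

    -- U is C(i,j) = Cᵢ ∪ T ∪ Cⱼ for some wheel and some i ≠ j.
    IsWheelCut : Subset n → Set
    IsWheelCut U = ∃[ w ] ∃[ T ] ∃[ C ] ∃[ S ] IsWheel {w} T C S ×
      ∃[ i ] ∃[ j ] i ≢ j × U ≡ C i ∪ T ∪ C j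

    record IsMatchingCutWrt (U A P W : Subset n) : Set where
      field
        cut          : IsCut U
        side         : IsSide U A
        P⊆U          : P ⊆ U
        κ-cut        : IsκCut W
        U─P⊆W        : U ─ P ⊆ W
        W⊆U∪A        : W ⊆ U ∪ A
        A─W-nonempty : Nonempty (A ─ W)
        disjointˡ    : Disjoint (P ∪ ∁ (U ∪ A)) W
        disjointʳ    : Disjoint (A ─ W) W
        separates    : Separates W (P ∪ ∁ (U ∪ A)) (A ─ W)

    -- U is always a matching cut of itself with respect to the empty set, so a
    -- matching cut with P unspecified is understood to have P nonempty.
    IsMatchingCut : (U A W : Subset n) → Set
    IsMatchingCut U A W = ∃[ P ] Nonempty P × IsMatchingCutWrt U A P W

    -- M is Match_{U;A}(P).
    IsMatch : (U A P M : Subset n) → Set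
    IsMatch U A P M = ∃[ W ] IsMatchingCutWrt U A P W × M ≡ W ─ U

    record IsCrossingMatchingCutWrt (Y A′ B′ P W : Subset n) : Set where
      field
        cut         : IsCut Y
        two-sides   : HasExactlyTwoSides Y A′ B′
        P-nonempty  : Nonempty P
        P⊆Y         : P ⊆ Y
        κ-cut       : IsκCut W
        W-meets-B′  : Nonempty (W ∩ B′)
        matching    : IsMatchingCutWrt Y A′ P ((Y ─ P) ∪ (W ∩ A′))

    IsCrossingMatchingCut : (Y W : Subset n) → Set
    IsCrossingMatchingCut Y W = ∃[ A′ ] ∃[ B′ ] ∃[ P ] IsCrossingMatchingCutWrt Y A′ B′ P W

    module _ (U A : Subset n) where

      Θ : Pred (Subset n) 0ℓ
      Θ P = P ⊆ U × ∃[ W ] IsMatchingCutWrt U A P W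

      Θ* : Pred (Subset n) 0ℓ
      Θ* I = ∃[ u ] u ∈ U × (∃[ P ] Θ P × u ∈ P) ×
        (∀ v → v ∈ I ⇔ (∀ P → Θ P → u ∈ P → v ∈ P))

      Is⋃Θ* : Pred (Subset n) 0ℓ
      Is⋃Θ* Q = ∀ v → v ∈ Q ⇔ (∃[ I ] Θ* I × v ∈ I)

      𝓛 : Pred (Subset n) 0ℓ
      𝓛 W = IsκCut W × W ≢ U × W ⊆ U ∪ A × ¬ IsSmall (κ ∸ 1) W

      -- D is S(W).  For W in 𝓛 there is exactly one such D: U ─ W is nonempty,
      -- and as U is a minimum cut each of its vertices has a neighbour in every side of U.
      IsS : (W D : Subset n) → Set
      IsS W D = IsSide W D × U ─ W ⊆ D × (∀ B → IsSide U B → B ≢ A → B ⊆ D)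

      R : Subset n → Pred (Fin n) 0ℓ
      R W v = ∃[ S ] IsS W S × ∃[ D ] IsSide W D × D ≢ S × v ∈ D

      IsMaximal : Pred (Subset n) 0ℓ
      IsMaximal W = 𝓛 W ×
        ¬ (∃[ W′ ] 𝓛 W′ × W′ ≢ W × (∀ {v} → R W v → R W′ v))

{-# OPTIONS --safe #-}

-- If the boundaries of L and L′ lie in κ-cuts W and W′, then L ∩ L′ and L ∪ L′ are bounded by
-- sets meet and join with |meet| + |join| ≤ |W| + |W′|; when L ∩ L′ and the common exterior are
-- nonempty, minimality of κ makes both of them κ-cuts.
--
-- Part 1.  Uncrossing the outer regions P ∪ ∁ (U ∪ A) shows that Θ is closed under unions
-- (|A| > 2κ leaves a vertex outside both cuts), so Q ∈ Θ.  If W meets Q and S(W) meets A, then W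
-- crosses X: uncrossing S(W) with the outer region O of X gives |X ∩ R(W)| = |W ∩ O|, and
-- (X ─ R(W)) ∪ (W ∩ O) is the required matching cut of X in its side O.
--
-- Part 2.  If R(W) and R(W′) overlap, the join J of R(W) and R(W′) is again in 𝓛 and dominates
-- both, unless J = U; in that case W and W′ form a 4-wheel having U as one of its cuts, or one of
-- them is a matching cut of U.

module Submission where

open import Defs
open import Data.Bool.Properties using () renaming (_≟_ to _≟ᵇ_)
open import Data.Empty using (⊥; ⊥-elim)
open import Data.Fin.Base using (Fin; zero; suc)
open import Data.Fin.Patterns using (0F; 1F; 2F; 3F)
open import Data.Fin.Properties using (any?; all?; _≟_)
open import Data.Fin.Subset using (Subset; inside; outside; _∈_; _∉_; _⊆_; _∩_; _∪_; _─_; _-_; ∁; ∣_∣; ⋃; ⁅_⁆; Nonempty)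
open import Data.Fin.Subset.Properties
open import Data.List.Base using (List; []; _∷_; map; removeAt; lookup; deduplicate; filter; allFin)
import Data.List.Membership.Propositional as List
open import Data.List.Membership.Propositional.Properties using (∈-allFin; ∈-map⁺; ∈-map⁻; ∈-filter⁺; ∈-filter⁻; ∈-deduplicate⁺; ∈-deduplicate⁻; ∈-lookup)
import Data.List.Relation.Unary.All as All
open import Data.List.Relation.Unary.AllPairs using (AllPairs; []; _∷_)
open import Data.List.Relation.Unary.Any using (here; there; index)
open import Data.List.Relation.Unary.Any.Properties using (lookup-index)
open import Data.List.Relation.Unary.Unique.Propositional using (Unique)
open import Data.List.Relation.Unary.Unique.DecPropositional.Properties using (deduplicate-!)
open import Data.Nat.Base using (ℕ; zero; suc; _+_; _*_; _∸_; _<_; _≤_)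
open import Data.Nat.ListAction using (sum)
open import Data.Nat.Properties as ℕ using (module ≤-Reasoning)
open import Algebra.Properties.CommutativeSemigroup ℕ.+-commutativeSemigroup using (x∙yz≈y∙xz)
open import Data.Product.Base using (∃-syntax; _×_; _,_; proj₁; proj₂)
open import Data.Product.Properties using () renaming (≡-dec to ×-≡-dec)
open import Data.Sum.Base using (_⊎_; inj₁; inj₂; [_,_]′)
open import Data.Vec.Base using ([]; _∷_; tabulate; here; there) renaming (lookup to lookupᵛ)
open import Data.Vec.Properties using (lookup∘tabulate; lookup⇒[]=; []=⇒lookup; ≡-dec)
open import Function.Base using (_∘_; id; case_of_)
open import Function.Bundles using (mk⇔; Equivalence)
open import Level using (0ℓ)
open import Relation.Binary.Construct.Closure.ReflexiveTransitive using (Star; ε; _◅_; _◅◅_)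
open import Relation.Binary.Definitions using (DecidableEquality)
open import Relation.Binary.PropositionalEquality.Core using (_≡_; _≢_; refl; sym; trans; cong; cong₂; subst)
open import Relation.Nullary.Decidable using (Dec; yes; no; does; dec-true; map′; _×-dec_; _→-dec_; _⊎-dec_; ¬?; decidable-stable; from-yes)
open import Relation.Nullary.Negation using (¬_; contradiction)
open import Relation.Unary using (Pred; Decidable)

private
  variable
    n : ℕ
    x : Fin n
    p q r s : Subset n

-- Finite subsets: membership, selection and counting.

_≟ˢ_ : DecidableEquality (Subset n)
_≟ˢ_ = ≡-dec _≟ᵇ_

∪⁻ : x ∈ p ∪ q → x ∈ p ⊎ x ∈ q
∪⁻ = x∈p∪q⁻ _ _

∪⁺ˡ : x ∈ p → x ∈ p ∪ q
∪⁺ˡ = x∈p∪q⁺ ∘ inj₁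

∪⁺ʳ : x ∈ q → x ∈ p ∪ q
∪⁺ʳ = x∈p∪q⁺ ∘ inj₂

∉∪⁺ : x ∉ p → x ∉ q → x ∉ p ∪ q
∉∪⁺ x∉p x∉q = [ x∉p , x∉q ]′ ∘ ∪⁻

∩⁻ : x ∈ p ∩ q → x ∈ p × x ∈ q
∩⁻ = x∈p∩q⁻ _ _

∩⁺ : x ∈ p → x ∈ q → x ∈ p ∩ q
∩⁺ x∈p x∈q = x∈p∩q⁺ (x∈p , x∈q)

─⁻ : x ∈ p ─ q → x ∈ p × x ∉ q
─⁻ {p = p} {q} x∈ = p─q⊆p p q x∈ , x∉q x∈
  where
  x∉q : ∀ {n} {x : Fin n} {p q} → x ∈ p ─ q → x ∉ q
  x∉q {x = zero}  {_ ∷ _} {outside ∷ _} _ ()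
  x∉q {x = zero}  {_ ∷ _} {inside ∷ _} ()
  x∉q {x = suc _} {_ ∷ _} {_ ∷ _} (there x∈p─q) (there x∈q) = x∉q x∈p─q x∈q

─⁺ : x ∈ p → x ∉ q → x ∈ p ─ q
─⁺ = x∈p∧x∉q⇒x∈p─q

∁⁻ : x ∈ ∁ p → x ∉ p
∁⁻ = x∈∁p⇒x∉p

∁⁺ : x ∉ p → x ∈ ∁ p
∁⁺ = x∉p⇒x∈∁p

∁∪⁻ : x ∈ ∁ (p ∪ q) → x ∉ p × x ∉ q
∁∪⁻ x∈ = ∁⁻ x∈ ∘ ∪⁺ˡ , ∁⁻ x∈ ∘ ∪⁺ʳ

∁∪⁺ : x ∉ p → x ∉ q → x ∈ ∁ (p ∪ q)
∁∪⁺ x∉p x∉q = ∁⁺ (∉∪⁺ x∉p x∉q)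

module _ {P : Pred (Fin n) 0ℓ} (P? : Decidable P) where

  select : Subset n
  select = tabulate (does ∘ P?)

  ∈-select⁺ : P x → x ∈ select
  ∈-select⁺ {x = x} Px =
    lookup⇒[]= x select (trans (lookup∘tabulate (does ∘ P?) x) (dec-true (P? x) Px))

  ∈-select⁻ : x ∈ select → P x
  ∈-select⁻ {x = x} x∈ with P? x | trans (sym (lookup∘tabulate (does ∘ P?) x)) ([]=⇒lookup x∈)
  ... | yes Px | _ = Px

∣p∪q∣+∣p∩q∣≡∣p∣+∣q∣ : ∀ (p q : Subset n) → ∣ p ∪ q ∣ + ∣ p ∩ q ∣ ≡ ∣ p ∣ + ∣ q ∣
∣p∪q∣+∣p∩q∣≡∣p∣+∣q∣ []            []            = refl
∣p∪q∣+∣p∩q∣≡∣p∣+∣q∣ (outside ∷ p) (outside ∷ q) = ∣p∪q∣+∣p∩q∣≡∣p∣+∣q∣ p q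
∣p∪q∣+∣p∩q∣≡∣p∣+∣q∣ (outside ∷ p) (inside  ∷ q) =
  trans (cong suc (∣p∪q∣+∣p∩q∣≡∣p∣+∣q∣ p q)) (sym (ℕ.+-suc ∣ p ∣ ∣ q ∣))
∣p∪q∣+∣p∩q∣≡∣p∣+∣q∣ (inside  ∷ p) (outside ∷ q) = cong suc (∣p∪q∣+∣p∩q∣≡∣p∣+∣q∣ p q)
∣p∪q∣+∣p∩q∣≡∣p∣+∣q∣ (inside  ∷ p) (inside  ∷ q) = cong suc
  (trans (ℕ.+-suc ∣ p ∪ q ∣ ∣ p ∩ q ∣)
  (trans (cong suc (∣p∪q∣+∣p∩q∣≡∣p∣+∣q∣ p q)) (sym (ℕ.+-suc ∣ p ∣ ∣ q ∣))))

-- Inclusion-exclusion turns each sum into a union plus an intersection, and these are compared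
-- separately.
∣∣-submodular : p ∪ q ⊆ r ∪ s → p ∩ q ⊆ r ∩ s → ∣ p ∣ + ∣ q ∣ ≤ ∣ r ∣ + ∣ s ∣
∣∣-submodular {p = p} {q} {r} {s} ∪⊆ ∩⊆ = begin
  ∣ p ∣ + ∣ q ∣          ≡⟨ ∣p∪q∣+∣p∩q∣≡∣p∣+∣q∣ p q ⟨
  ∣ p ∪ q ∣ + ∣ p ∩ q ∣  ≤⟨ ℕ.+-mono-≤ (p⊆q⇒∣p∣≤∣q∣ ∪⊆) (p⊆q⇒∣p∣≤∣q∣ ∩⊆) ⟩
  ∣ r ∪ s ∣ + ∣ r ∩ s ∣  ≡⟨ ∣p∪q∣+∣p∩q∣≡∣p∣+∣q∣ r s ⟩
  ∣ r ∣ + ∣ s ∣          ∎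
  where open ≤-Reasoning

∣p∪q∣≤∣p∣+∣q∣ : ∀ (p q : Subset n) → ∣ p ∪ q ∣ ≤ ∣ p ∣ + ∣ q ∣
∣p∪q∣≤∣p∣+∣q∣ p q = ℕ.≤-trans (ℕ.m≤m+n _ _) (ℕ.≤-reflexive (∣p∪q∣+∣p∩q∣≡∣p∣+∣q∣ p q))

∣p∪q∣-disjoint : ∀ {p q : Subset n} → (∀ {x} → x ∈ p → x ∉ q) → ∣ p ∪ q ∣ ≡ ∣ p ∣ + ∣ q ∣
∣p∪q∣-disjoint {n} {p} {q} p#q = trans (sym (ℕ.+-identityʳ _))
  (trans (cong (∣ p ∪ q ∣ +_) (sym ∣p∩q∣≡0)) (∣p∪q∣+∣p∩q∣≡∣p∣+∣q∣ p q))
  where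
  ∣p∩q∣≡0 : ∣ p ∩ q ∣ ≡ 0
  ∣p∩q∣≡0 = trans (cong ∣_∣ (Empty-unique (λ (_ , x∈) → p#q (proj₁ (∩⁻ x∈)) (proj₂ (∩⁻ x∈))))) (∣⊥∣≡0 n)

⊈-witness : ¬ (p ⊆ q) → ∃[ x ] x ∈ p × x ∉ q
⊈-witness {p = p} {q} p⊈q with nonempty? (p ─ q)
... | yes (x , x∈) = x , ─⁻ x∈
... | no  p─q-empty = contradiction
  (λ {x} x∈p → decidable-stable (x ∈? q) λ x∉q → p─q-empty (x , ─⁺ x∈p x∉q)) p⊈q

∣∣<⇒⊈ : ∣ q ∣ < ∣ p ∣ → ∃[ x ] x ∈ p × x ∉ q
∣∣<⇒⊈ q<p = ⊈-witness λ p⊆q → ℕ.<⇒≱ q<p (p⊆q⇒∣p∣≤∣q∣ p⊆q)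

⊆∧∣∣≥⇒≡ : p ⊆ q → ∣ q ∣ ≤ ∣ p ∣ → p ≡ q
⊆∧∣∣≥⇒≡ {p = p} {q} p⊆q ∣q∣≤∣p∣ = ⊆-antisym p⊆q
  λ {x} x∈q → decidable-stable (x ∈? p) λ x∉p → ℕ.<⇒≱ (p⊂q⇒∣p∣<∣q∣ (p⊆q , x , x∈q , x∉p)) ∣q∣≤∣p∣

sum-removeAt : ∀ (As : List (Subset n)) i →
  sum (map ∣_∣ As) ≡ ∣ lookup As i ∣ + sum (map ∣_∣ (removeAt As i))
sum-removeAt (A ∷ As) zero = refl
sum-removeAt (A ∷ As) (suc i) =
  trans (cong (∣ A ∣ +_) (sum-removeAt As i)) (x∙yz≈y∙xz ∣ A ∣ ∣ lookup As i ∣ _)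

∈-⋃⁻ : ∀ (As : List (Subset n)) → x ∈ ⋃ As → ∃[ A ] A List.∈ As × x ∈ A
∈-⋃⁻ []       x∈ = contradiction x∈ ∉⊥
∈-⋃⁻ (A ∷ As) x∈ with ∪⁻ x∈
... | inj₁ x∈A = A , here refl , x∈A
... | inj₂ x∈⋃ = let B , B∈ , x∈B = ∈-⋃⁻ As x∈⋃ in B , there B∈ , x∈B

∈-⋃⁺ : ∀ {As : List (Subset n)} {A} → A List.∈ As → x ∈ A → x ∈ ⋃ As
∈-⋃⁺ (here refl) x∈A = ∪⁺ˡ x∈A
∈-⋃⁺ (there A∈) x∈A = ∪⁺ʳ (∈-⋃⁺ A∈ x∈A)

sum-disjoint : ∀ {As : List (Subset n)} →
  AllPairs (λ A B → ∀ {x} → x ∈ A → x ∉ B) As → sum (map ∣_∣ As) ≡ ∣ ⋃ As ∣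
sum-disjoint {n} [] = sym (∣⊥∣≡0 n)
sum-disjoint {As = A ∷ As} (A#As ∷ As#) = trans (cong (∣ A ∣ +_) (sum-disjoint As#))
  (sym (∣p∪q∣-disjoint λ x∈A x∈⋃ → let B , B∈ , x∈B = ∈-⋃⁻ As x∈⋃ in All.lookup A#As B∈ x∈A x∈B))

-- Sizes never exceed `m`, so enlarging steps must run out; `go` counts the remaining ones by
-- `m ≤ size t + k`. It serves both to grow reachable sets and to climb to maximal cuts.
saturate : ∀ {a ℓ₁ ℓ₂} {T : Set a} {P : Pred T ℓ₁} {Q : Pred T ℓ₂} (size : T → ℕ) (m : ℕ) →
  (∀ t → size t ≤ m) →
  (∀ t → P t → Q t ⊎ (∃[ t′ ] P t′ × size t < size t′)) →
  ∀ t → P t → ∃[ t′ ] P t′ × Q t′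
saturate {P = P} {Q} size m bounded step t Pt = go m t Pt (ℕ.m≤n+m m (size t))
  where
  go : ∀ k t → P t → m ≤ size t + k → ∃[ t′ ] P t′ × Q t′
  go k t Pt m≤ with step t Pt
  ... | inj₁ Qt = t , Pt , Qt
  go zero t Pt m≤ | inj₂ (t′ , Pt′ , t<t′) =
    contradiction (ℕ.≤-trans t<t′ (ℕ.≤-trans (bounded t′) (subst (m ≤_) (ℕ.+-identityʳ _) m≤))) (ℕ.<-irrefl refl)
  go (suc k) t Pt m≤ | inj₂ (t′ , Pt′ , t<t′) =
    go k t′ Pt′ (ℕ.≤-trans m≤ (ℕ.≤-trans (ℕ.≤-reflexive (ℕ.+-suc (size t) k)) (ℕ.+-monoˡ-≤ k t<t′)))

-- Regions bounded by vertex sets, and the sides of a cut.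

module _ {n : ℕ} (G : Graph n) where
  open Graph G renaming (sym to edge-sym)

  private
    variable
      y : Fin n
      A D D′ L L′ U W W′ : Subset n

  Step : Subset n → Fin n → Fin n → Set
  Step U a b = Edge a b × b ∉ U

  -- The boundary of `L` lies in `W`; `L` may be empty or disconnected. Being stated edge by edge,
  -- this is a finite check, and it survives complements, intersections and unions of regions.
  record Encloses (W L : Subset n) : Set where
    field
      disjoint : x ∈ L → x ∉ W
      closed   : x ∈ L → Edge x y → y ∉ W → y ∈ L

  open Encloses

  encloses? : ∀ W L → Dec (Encloses W L)
  encloses? W L = map′
    (λ (dis , clo) → record { disjoint = dis _ ; closed = clo _ _ })
    (λ W∣L → (λ x → disjoint W∣L) , (λ x y → closed W∣L))
    (all? (λ x → (x ∈? L) →-dec ¬? (x ∈? W)) ×-dec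
     all? (λ x → all? λ y → (x ∈? L) →-dec edge? x y →-dec ¬? (y ∈? W) →-dec (y ∈? L)))

  encloses-Star : Encloses W L → x ∈ L → Star (Step W) x y → y ∈ L
  encloses-Star W∣L x∈L ε = x∈L
  encloses-Star W∣L x∈L ((e , z∉W) ◅ zs) = encloses-Star W∣L (closed W∣L x∈L e z∉W) zs

  encloses⇒cut : Encloses W L → x ∈ L → y ∉ L → y ∉ W → IsCut G W
  encloses⇒cut W∣L x∈L y∉L y∉W =
    _ , _ , disjoint W∣L x∈L , y∉W , λ (_ , path) → y∉L (encloses-Star W∣L x∈L path)

  encloses-∁ : Encloses W L → Encloses W (∁ (W ∪ L))
  encloses-∁ W∣L .disjoint x∈ = proj₁ (∁∪⁻ x∈)
  encloses-∁ W∣L .closed x∈ e y∉W = ∁∪⁺ y∉W λ y∈L →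
    proj₂ (∁∪⁻ x∈) (closed W∣L y∈L (edge-sym e) (proj₁ (∁∪⁻ x∈)))

  -- For enclosed regions, `meet` is the union of `W ∩ W′`, `W ∩ L′` and `L ∩ W′`.
  meet join : (L W L′ W′ : Subset n) → Subset n
  meet L W L′ W′ = (W ∪ W′) ∩ (L ∪ W) ∩ (L′ ∪ W′)
  join L W L′ W′ = (W ∪ W′) ─ (L ∪ L′)

  encloses-meet : Encloses W L → Encloses W′ L′ → Encloses (meet L W L′ W′) (L ∩ L′)
  encloses-meet W∣L W′∣L′ .disjoint x∈ x∈meet = [ disjoint W∣L (proj₁ (∩⁻ x∈)) , disjoint W′∣L′ (proj₂ (∩⁻ x∈)) ]′
    (∪⁻ (proj₁ (∩⁻ x∈meet)))
  encloses-meet {W} {L} {W′} {L′} W∣L W′∣L′ .closed {x} {y} x∈ e y∉ with y ∈? W | y ∈? W′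
  ... | no y∉W | no y∉W′ = ∩⁺ (closed W∣L (proj₁ (∩⁻ x∈)) e y∉W) (closed W′∣L′ (proj₂ (∩⁻ x∈)) e y∉W′)
  ... | yes y∈W | yes y∈W′ = contradiction (∩⁺ (∪⁺ˡ y∈W) (∩⁺ (∪⁺ʳ y∈W) (∪⁺ʳ y∈W′))) y∉
  ... | yes y∈W | no y∉W′ = contradiction
    (∩⁺ (∪⁺ˡ y∈W) (∩⁺ (∪⁺ʳ y∈W) (∪⁺ˡ (closed W′∣L′ (proj₂ (∩⁻ x∈)) e y∉W′)))) y∉
  ... | no y∉W | yes y∈W′ = contradiction
    (∩⁺ (∪⁺ʳ y∈W′) (∩⁺ (∪⁺ˡ (closed W∣L (proj₁ (∩⁻ x∈)) e y∉W)) (∪⁺ʳ y∈W′))) y∉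

  encloses-join : Encloses W L → Encloses W′ L′ → Encloses (join L W L′ W′) (L ∪ L′)
  encloses-join W∣L W′∣L′ .disjoint x∈ x∈join = proj₂ (─⁻ x∈join) x∈
  encloses-join {W} {L} {W′} {L′} W∣L W′∣L′ .closed {x} {y} x∈ e y∉ = decidable-stable (y ∈? (L ∪ L′)) λ y∉L∪L′ →
    let y∉W∪W′ = λ y∈W∪W′ → y∉ (─⁺ y∈W∪W′ y∉L∪L′) in
    y∉L∪L′ (case ∪⁻ x∈ of λ where
      (inj₁ x∈L)  → ∪⁺ˡ (closed W∣L x∈L e (y∉W∪W′ ∘ ∪⁺ˡ))
      (inj₂ x∈L′) → ∪⁺ʳ (closed W′∣L′ x∈L′ e (y∉W∪W′ ∘ ∪⁺ʳ)))

  -- A vertex counted twice on the left lies outside `L` and `L′`, yet in `L ∪ W` and in `L′ ∪ W′`;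
  -- hence it is in both cuts and is counted twice on the right.
  ∣meet∣+∣join∣≤ : ∀ L W L′ W′ → ∣ meet L W L′ W′ ∣ + ∣ join L W L′ W′ ∣ ≤ ∣ W ∣ + ∣ W′ ∣
  ∣meet∣+∣join∣≤ L W L′ W′ = ∣∣-submodular {p = meet L W L′ W′} {join L W L′ W′} {W} {W′}
    (λ x∈ → [ proj₁ ∘ ∩⁻ , proj₁ ∘ ─⁻ ]′ (∪⁻ x∈))
    (λ x∈ → let x∈meet , x∈join = ∩⁻ x∈ ; _ , x∉ = ─⁻ x∈join ; x∈L∪W , x∈L′∪W′ = ∩⁻ (proj₂ (∩⁻ x∈meet)) in
      ∩⁺ ([ ⊥-elim ∘ x∉ ∘ ∪⁺ˡ , id ]′ (∪⁻ x∈L∪W)) ([ ⊥-elim ∘ x∉ ∘ ∪⁺ʳ , id ]′ (∪⁻ x∈L′∪W′)))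

  abstract
    -- Starting from `x` alone, one neighbour outside `U` is added at a time until none is left.
    -- This makes reachability, hence sides and cuts, decidable; `abstract` keeps the search from
    -- unfolding.
    reachable : ∀ U x → ∃[ L ] ((x ∈ L × (∀ {y} → y ∈ L → Star (Step U) x y)) ×
                                (∀ {a b} → a ∈ L → Edge a b → b ∉ U → b ∈ L))
    reachable U x = saturate ∣_∣ n ∣p∣≤n grow ⁅ x ⁆
      (x∈⁅x⁆ x , λ y∈ → subst (Star (Step U) x) (sym (x∈⁅y⁆⇒x≡y x y∈)) ε)
      where
      grow : ∀ L → x ∈ L × (∀ {y} → y ∈ L → Star (Step U) x y) →
        (∀ {a b} → a ∈ L → Edge a b → b ∉ U → b ∈ L) ⊎
        (∃[ L′ ] (x ∈ L′ × (∀ {y} → y ∈ L′ → Star (Step U) x y)) × ∣ L ∣ < ∣ L′ ∣)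
      grow L (x∈L , paths)
        with any? (λ a → any? λ b → (a ∈? L) ×-dec edge? a b ×-dec ¬? (b ∈? U) ×-dec ¬? (b ∈? L))
      ... | yes (a , b , a∈L , e , b∉U , b∉L) = inj₂
        ( L ∪ ⁅ b ⁆
        , ( ∪⁺ˡ x∈L
          , λ y∈ → [ paths , (λ y∈⁅b⁆ → subst (Star (Step U) x) (sym (x∈⁅y⁆⇒x≡y b y∈⁅b⁆))
                                           (paths a∈L ◅◅ (e , b∉U) ◅ ε)) ]′ (∪⁻ y∈))
        , p⊂q⇒∣p∣<∣q∣ (∪⁺ˡ , b , ∪⁺ʳ (x∈⁅x⁆ b) , b∉L))
      ... | no none = inj₁ λ {a} {b} a∈L e b∉U →
        decidable-stable (b ∈? L) λ b∉L → none (a , b , a∈L , e , b∉U , b∉L)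

  -- A side of U only for x ∉ U.
  component : Subset n → Fin n → Subset n
  component U x = proj₁ (reachable U x)

  x∈component : ∀ U x → x ∈ component U x
  x∈component U x = proj₁ (proj₁ (proj₂ (reachable U x)))

  component⁻ : ∀ U x → y ∈ component U x → Star (Step U) x y
  component⁻ U x = proj₂ (proj₁ (proj₂ (reachable U x)))

  component⁺ : ∀ U x → Star (Step U) x y → y ∈ component U x
  component⁺ U x = go (x∈component U x)
    where
    go : ∀ {a} → a ∈ component U x → Star (Step U) a y → y ∈ component U x
    go a∈ ε = a∈
    go a∈ ((e , b∉U) ◅ path) = go (proj₂ (proj₂ (reachable U x)) a∈ e b∉U) path

  component-side : x ∉ U → IsSide G U (component U x)
  component-side {x} {U} x∉U = x , x∉U , λ y → mk⇔ (λ y∈ → x∉U , component⁻ U x y∈) (component⁺ U x ∘ proj₂)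

  side≡component : (side : IsSide G U A) → A ≡ component U (proj₁ side)
  side≡component {U} (x , x∉U , spec) = ⊆-antisym
    (λ {y} y∈A → component⁺ U x (proj₂ (Equivalence.to (spec y) y∈A)))
    (λ {y} y∈ → Equivalence.from (spec y) (x∉U , component⁻ U x y∈))

  side⇒encloses : IsSide G U A → Encloses U A
  side⇒encloses {U} {A} (x , x∉U , spec) = record
    { disjoint = λ {y} y∈A → end∉U x∉U (proj₂ (Equivalence.to (spec y) y∈A))
    ; closed   = λ {y} {z} y∈A e z∉U →
        Equivalence.from (spec z) (x∉U , (proj₂ (Equivalence.to (spec y) y∈A) ◅◅ (e , z∉U) ◅ ε))
    }
    where
    end∉U : ∀ {a b} → a ∉ U → Star (Step U) a b → b ∉ U
    end∉U a∉U ε = a∉U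
    end∉U _ ((_ , c∉U) ◅ path) = end∉U c∉U path

  reverse-path : x ∉ U → Star (Step U) x y → Star (Step U) y x
  reverse-path x∉U ε = ε
  reverse-path x∉U ((e , z∉U) ◅ path) = reverse-path z∉U path ◅◅ (edge-sym e , x∉U) ◅ ε

  sides-≡ : IsSide G U D → IsSide G U D′ → x ∈ D → x ∈ D′ → D ≡ D′
  sides-≡ {x = x} D-side D′-side x∈D x∈D′ = ⊆-antisym (⊆ D-side D′-side x∈D x∈D′) (⊆ D′-side D-side x∈D′ x∈D)
    where
    ⊆ : IsSide G U D → IsSide G U D′ → x ∈ D → x ∈ D′ → D ⊆ D′
    ⊆ (d , d∉U , spec) D′-side x∈D x∈D′ {y} y∈D = encloses-Star (side⇒encloses D′-side) x∈D′
      (reverse-path d∉U (proj₂ (Equivalence.to (spec x) x∈D)) ◅◅ proj₂ (Equivalence.to (spec y) y∈D))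

  side-⊆ : IsSide G U D → (∀ {a b} → a ∈ D → b ∈ D → a ∈ L → Edge a b → b ∈ L) →
    x ∈ D → x ∈ L → D ⊆ L
  side-⊆ {U} {D} {L} {x} D-side step x∈D x∈L {y} y∈D =
    go x∈D x∈L (component⁻ U x (subst (y ∈_) (sides-≡ D-side (component-side x∉U) x∈D (x∈component U x)) y∈D))
    where
    D-enclosed = side⇒encloses D-side
    x∉U = disjoint D-enclosed x∈D
    go : ∀ {a} → a ∈ D → a ∈ L → Star (Step U) a y → y ∈ L
    go a∈D a∈L ε = a∈L
    go a∈D a∈L ((e , b∉U) ◅ path) = let b∈D = closed D-enclosed a∈D e b∉U in go b∈D (step a∈D b∈D a∈L e) path

  -- A connected set that misses `W` cannot cross the boundary of `L`. Most containments between
  -- sides and regions below rest on this.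
  side-⊆-enclosed : IsSide G U D → Encloses W L → (∀ {a} → a ∈ D → a ∉ W) → x ∈ D → x ∈ L → D ⊆ L
  side-⊆-enclosed D-side W∣L D#W = side-⊆ D-side λ _ b∈D a∈L e → closed W∣L a∈L e (D#W b∈D)

  side-nonempty : IsSide G U D → Nonempty D
  side-nonempty (x , x∉U , spec) = x , Equivalence.from (spec x) (x∉U , ε)

  side? : ∀ U → Decidable (IsSide G U)
  side? U A = map′
    (λ (x , x∉U , A≡) → subst (IsSide G U) (sym A≡) (component-side x∉U))
    (λ side → proj₁ side , proj₁ (proj₂ side) , side≡component side)
    (any? λ x → ¬? (x ∈? U) ×-dec (A ≟ˢ component U x))

  cut? : Decidable (IsCut G)
  cut? U = any? λ x → any? λ y → ¬? (x ∈? U) ×-dec ¬? (y ∈? U) ×-dec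
    ¬? (map′ (λ (x∉U , y∈) → x∉U , component⁻ U x y∈) (λ (x∉U , path) → x∉U , component⁺ U x path)
         (¬? (x ∈? U) ×-dec (y ∈? component U x)))

  sides : Subset n → List (Subset n)
  sides U = deduplicate _≟ˢ_ (map (component U) (filter (λ x → ¬? (x ∈? U)) (allFin n)))

  sides-enumerated : ∀ U → EnumeratesSides G U (sides U)
  sides-enumerated U = deduplicate-! _≟ˢ_ _ , λ A → mk⇔ to from
    where
    to : A List.∈ sides U → IsSide G U A
    to A∈ with ∈-map⁻ (component U) (∈-deduplicate⁻ _≟ˢ_ _ A∈)
    ... | x , x∈ , refl = component-side (proj₂ (∈-filter⁻ (λ x → ¬? (x ∈? U)) {xs = allFin n} x∈))
    from : IsSide G U A → A List.∈ sides U
    from side = ∈-deduplicate⁺ _≟ˢ_ (subst (List._∈ _) (sym (side≡component side))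
      (∈-map⁺ (component U) (∈-filter⁺ (λ x → ¬? (x ∈? U)) (∈-allFin _) (proj₁ (proj₂ side)))))

  -- The sides are pairwise disjoint and cover `∁ U`, so removing one from the total leaves exactly
  -- what lies outside it and `U`.
  sum-other-sides : ∀ {As} → EnumeratesSides G U As → ∀ i →
    sum (map ∣_∣ (removeAt As i)) ≡ ∣ ∁ (U ∪ lookup As i) ∣
  sum-other-sides {U} {As} (unique , spec) i = ℕ.+-cancelˡ-≡ ∣ Aᵢ ∣ _ _
    (trans (sym (sum-removeAt As i)) (trans (sum-disjoint (pairwise unique λ A∈ → Equivalence.to (spec _) A∈))
      (trans (cong ∣_∣ ⋃As≡) (∣p∪q∣-disjoint {p = Aᵢ} λ x∈A x∈∁ → proj₂ (∁∪⁻ x∈∁) x∈A))))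
    where
    Aᵢ = lookup As i
    Aᵢ-side : IsSide G U Aᵢ
    Aᵢ-side = Equivalence.to (spec Aᵢ) (∈-lookup i)
    pairwise : ∀ {As} → Unique As → (∀ {A} → A List.∈ As → IsSide G U A) →
      AllPairs (λ A B → ∀ {x} → x ∈ A → x ∉ B) As
    pairwise [] _ = []
    pairwise (A∉As ∷ As!) all-sides =
      All.tabulate (λ B∈ x∈A x∈B → All.lookup A∉As B∈
        (sides-≡ (all-sides (here refl)) (all-sides (there B∈)) x∈A x∈B))
      ∷ pairwise As! (all-sides ∘ there)
    ⋃As≡ : ⋃ As ≡ Aᵢ ∪ ∁ (U ∪ Aᵢ)
    ⋃As≡ = ⊆-antisym
      (λ {x} x∈ → let B , B∈ , x∈B = ∈-⋃⁻ As x∈ in case x ∈? Aᵢ of λ where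
        (yes x∈A) → ∪⁺ˡ x∈A
        (no x∉A)  → ∪⁺ʳ (∁∪⁺ (disjoint (side⇒encloses (Equivalence.to (spec B) B∈)) x∈B) x∉A))
      (λ {x} x∈ → let x∉U = [ disjoint (side⇒encloses Aᵢ-side) , proj₁ ∘ ∁∪⁻ ]′ (∪⁻ x∈) in
        ∈-⋃⁺ (Equivalence.from (spec _) (component-side x∉U)) (x∈component U x))

  -- Smallness without lists, in a form where two cuts are compared by a mere inclusion of
  -- complements.
  HasSmallComplement : ℕ → Subset n → Set
  HasSmallComplement t U = ∃[ D ] IsSide G U D × ∣ ∁ (U ∪ D) ∣ ≤ t

  small⁺ : ∀ {t} → HasSmallComplement t U → IsSmall G t U
  small⁺ {U} {t} (D , D-side , ≤t) = sides U , sides-enumerated U , i ,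
    subst (_≤ t) (sym (sum-other-sides (sides-enumerated U) i))
      (subst (λ D → ∣ ∁ (U ∪ D) ∣ ≤ t) (lookup-index D∈) ≤t)
    where
    D∈ = Equivalence.from (proj₂ (sides-enumerated U) D) D-side
    i = index D∈

  small⁻ : ∀ {t} → IsSmall G t U → HasSmallComplement t U
  small⁻ {U} {t} (As , enum , i , ≤t) =
    lookup As i , Equivalence.to (proj₂ enum _) (∈-lookup i) , subst (_≤ t) (sum-other-sides enum i) ≤t

  small? : ∀ t U → Dec (IsSmall G t U)
  small? t U = map′ small⁺ small⁻ (anySubset? λ D → side? U D ×-dec (∣ ∁ (U ∪ D) ∣ ℕ.≤? t))

-- Two crossing cuts as a 4-wheel.

module _ {n : ℕ} (G : Graph n) (κ : ℕ) where
  open Graph G renaming (sym to edge-sym)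
  open Encloses

  module Grid (W L W′ L′ : Subset n)
    (W∣L : Encloses G W L) (W′∣L′ : Encloses G W′ L′) where

    line : Subset n → Subset n → Fin 3 → Subset n
    line L W 0F = L
    line L W 1F = W
    line L W 2F = ∁ (W ∪ L)

    locate : ∀ L W x → ∃[ k ] x ∈ line L W k
    locate L W x with x ∈? L | x ∈? W
    ... | yes x∈L | _       = 0F , x∈L
    ... | no _    | yes x∈W = 1F , x∈W
    ... | no x∉L  | no x∉W  = 2F , ∁∪⁺ x∉W x∉L

    lines-disjoint : ∀ {L W} → Encloses G W L → ∀ k l → x ∈ line L W k → x ∈ line L W l → k ≡ l
    lines-disjoint W∣L 0F 0F _  _  = refl
    lines-disjoint W∣L 0F 1F x∈ y∈ = contradiction y∈ (disjoint W∣L x∈)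
    lines-disjoint W∣L 0F 2F x∈ y∈ = contradiction x∈ (proj₂ (∁∪⁻ y∈))
    lines-disjoint W∣L 1F 0F x∈ y∈ = contradiction x∈ (disjoint W∣L y∈)
    lines-disjoint W∣L 1F 1F _  _  = refl
    lines-disjoint W∣L 1F 2F x∈ y∈ = contradiction x∈ (proj₁ (∁∪⁻ y∈))
    lines-disjoint W∣L 2F 0F x∈ y∈ = contradiction y∈ (proj₂ (∁∪⁻ x∈))
    lines-disjoint W∣L 2F 1F x∈ y∈ = contradiction y∈ (proj₁ (∁∪⁻ x∈))
    lines-disjoint W∣L 2F 2F _  _  = refl

    -- Rows give the position relative to (L , W), columns that relative to (L′ , W′):
    -- 0 is inside, 1 on the cut, 2 outside.  The cells around the central one are, in
    -- cyclic order, alternately the Sᵢ (sectors) and the Cᵢ (spokes) of a 4-wheel.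
    row column : Fin 3 → Subset n
    row    = line L W
    column = line L′ W′

    cell : Fin 3 × Fin 3 → Subset n
    cell (i , j) = row i ∩ column j

    -- The order is left free because `i ⊕ 2` wraps around: the wheel reads each cut once from
    -- either end.
    covers : (i j k : Fin 3) → Set
    covers i j k = ∀ l → l ≡ i ⊎ l ≡ j ⊎ l ≡ k

    row≡ : ∀ i {j k l} → covers j k l → cell (i , j) ∪ cell (i , k) ∪ cell (i , l) ≡ row i
    row≡ i {j} {k} {l} all = ⊆-antisym
      (λ x∈ → [ proj₁ ∘ ∩⁻ , [ proj₁ ∘ ∩⁻ , proj₁ ∘ ∩⁻ ]′ ∘ ∪⁻ ]′ (∪⁻ x∈))
      (λ {x} x∈ → let m , x∈m = locate L′ W′ x in case all m of λ where
        (inj₁ eq)        → ∪⁺ˡ (∩⁺ x∈ (subst (λ m → x ∈ column m) eq x∈m))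
        (inj₂ (inj₁ eq)) → ∪⁺ʳ (∪⁺ˡ (∩⁺ x∈ (subst (λ m → x ∈ column m) eq x∈m)))
        (inj₂ (inj₂ eq)) → ∪⁺ʳ (∪⁺ʳ (∩⁺ x∈ (subst (λ m → x ∈ column m) eq x∈m))))

    column≡ : ∀ i {j k l} → covers j k l → cell (j , i) ∪ cell (k , i) ∪ cell (l , i) ≡ column i
    column≡ i {j} {k} {l} all = ⊆-antisym
      (λ x∈ → [ proj₂ ∘ ∩⁻ , [ proj₂ ∘ ∩⁻ , proj₂ ∘ ∩⁻ ]′ ∘ ∪⁻ ]′ (∪⁻ x∈))
      (λ {x} x∈ → let m , x∈m = locate L W x in case all m of λ where
        (inj₁ eq)        → ∪⁺ˡ (∩⁺ (subst (λ m → x ∈ row m) eq x∈m) x∈)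
        (inj₂ (inj₁ eq)) → ∪⁺ʳ (∪⁺ˡ (∩⁺ (subst (λ m → x ∈ row m) eq x∈m) x∈))
        (inj₂ (inj₂ eq)) → ∪⁺ʳ (∪⁺ʳ (∩⁺ (subst (λ m → x ∈ row m) eq x∈m) x∈)))

    cells-disjoint : ∀ {c d} → c ≢ d → Disjoint (cell c) (cell d)
    cells-disjoint c≢d (x , x∈) =
      let x∈c , x∈d = ∩⁻ x∈
          x∈c₁ , x∈c₂ = ∩⁻ x∈c
          x∈d₁ , x∈d₂ = ∩⁻ x∈d
      in c≢d (cong₂ _,_ (lines-disjoint W∣L _ _ x∈c₁ x∈d₁) (lines-disjoint W′∣L′ _ _ x∈c₂ x∈d₂))

    -- Numbered so that `spoke i` and `spoke (i ⊕ 2)` are opposite ends of `W` or of `W′`, while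
    -- `sector i`, `spoke (i ⊕ 1)`, `sector (i ⊕ 1)` fill an outer row or column.
    spoke sector : Fin 4 → Fin 3 × Fin 3
    spoke  = lookupᵛ ((1F , 0F) ∷ (0F , 1F) ∷ (1F , 2F) ∷ (2F , 1F) ∷ [])
    sector = lookupᵛ ((0F , 0F) ∷ (0F , 2F) ∷ (2F , 2F) ∷ (2F , 0F) ∷ [])

    hub : Fin 3 × Fin 3
    hub = 1F , 1F

    _≟ᶜ_ : DecidableEquality (Fin 3 × Fin 3)
    _≟ᶜ_ = ×-≡-dec _≟_ _≟_

    spoke-injective : ∀ i j → spoke i ≡ spoke j → i ≡ j
    spoke-injective = from-yes (all? λ i → all? λ j → (spoke i ≟ᶜ spoke j) →-dec (i ≟ j))

    sector-injective : ∀ i j → sector i ≡ sector j → i ≡ j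
    sector-injective = from-yes (all? λ i → all? λ j → (sector i ≟ᶜ sector j) →-dec (i ≟ j))

    classify : ∀ i j → (i , j) ≡ hub ⊎ (∃[ k ] (i , j) ≡ spoke k) ⊎ (∃[ k ] (i , j) ≡ sector k)
    classify = from-yes (all? λ i → all? λ j →
      ((i , j) ≟ᶜ hub) ⊎-dec any? (λ k → (i , j) ≟ᶜ spoke k) ⊎-dec any? (λ k → (i , j) ≟ᶜ sector k))

    encloses⇒separates : ∀ {W L} → Encloses G W L → Separates G W L (∁ (W ∪ L))
    encloses⇒separates W∣L x∈L y∈ (_ , path) = proj₂ (∁∪⁻ y∈) (encloses-Star G W∣L x∈L path)

    separates-parts : ∀ {W L cut part} → cut ≡ W → part ≡ L → Encloses G W L → Separates G cut part (∁ (cut ∪ part))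
    separates-parts refl refl = encloses⇒separates

    covers? : ∀ i j k → Dec (covers i j k)
    covers? i j k = all? λ l → (l ≟ i) ⊎-dec (l ≟ j) ⊎-dec (l ≟ k)

    012-covers : covers 0F 1F 2F
    012-covers = from-yes (covers? 0F 1F 2F)

    210-covers : covers 2F 1F 0F
    210-covers = from-yes (covers? 2F 1F 0F)

    cuts : ∀ i → let cut = cell (spoke i) ∪ cell hub ∪ cell (spoke (i ⊕ 2)) in cut ≡ W ⊎ cut ≡ W′
    cuts 0F = inj₁ (row≡ 1F 012-covers)
    cuts 1F = inj₂ (column≡ 1F 012-covers)
    cuts 2F = inj₁ (row≡ 1F 210-covers)
    cuts 3F = inj₂ (column≡ 1F 210-covers)

    wheel : IsκCut G κ W → IsκCut G κ W′ →
      (∀ i → Nonempty (cell (spoke i))) → (∀ i → Nonempty (cell (sector i))) →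
      IsWheel G κ (cell hub) (cell ∘ spoke) (cell ∘ sector)
    wheel W-cut W′-cut spokes sectors = record
      { 4≤w          = ℕ.≤-refl
      ; cover        = λ v → let i , v∈i = locate L W v ; j , v∈j = locate L′ W′ v ; v∈ = ∩⁺ v∈i v∈j in
          case classify i j of λ where
            (inj₁ eq)              → inj₁ (subst (λ c → v ∈ cell c) eq v∈)
            (inj₂ (inj₁ (k , eq))) → inj₂ (inj₁ (k , subst (λ c → v ∈ cell c) eq v∈))
            (inj₂ (inj₂ (k , eq))) → inj₂ (inj₂ (k , subst (λ c → v ∈ cell c) eq v∈))
      ; T-C-disjoint = λ i → cells-disjoint (from-yes (all? λ i → ¬? (hub ≟ᶜ spoke i)) i)
      ; T-S-disjoint = λ i → cells-disjoint (from-yes (all? λ i → ¬? (hub ≟ᶜ sector i)) i)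
      ; C-S-disjoint = λ i j → cells-disjoint (from-yes (all? λ i → all? λ j → ¬? (spoke i ≟ᶜ sector j)) i j)
      ; C-disjoint   = λ {i} {j} i≢j → cells-disjoint (i≢j ∘ spoke-injective i j)
      ; S-disjoint   = λ {i} {j} i≢j → cells-disjoint (i≢j ∘ sector-injective i j)
      ; C-nonempty   = spokes
      ; S-nonempty   = sectors
      ; κ-cut        = λ i → [ (λ eq → subst (IsκCut G κ) (sym eq) W-cut)
                             , (λ eq → subst (IsκCut G κ) (sym eq) W′-cut) ]′ (cuts i)
      ; disconnects  = λ where
          0F → separates-parts (row≡ 1F 012-covers)
                 (row≡ 0F 012-covers) W∣L
          1F → separates-parts (column≡ 1F 012-covers)
                 (column≡ 2F 012-covers) (encloses-∁ G W′∣L′)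
          2F → separates-parts (row≡ 1F 210-covers)
                 (row≡ 2F 210-covers) (encloses-∁ G W∣L)
          3F → separates-parts (column≡ 1F 210-covers)
                 (column≡ 0F 210-covers) W′∣L′
      }

    -- This exhibits the join as the wheel cut `C(2,3)`, to be contradicted when the join is `U`.
    join≡ : join G L W L′ W′ ≡ cell (spoke 2F) ∪ cell hub ∪ cell (spoke 3F)
    join≡ = ⊆-antisym
      (λ {x} x∈ → let x∈W∪W′ , x∉L∪L′ = ─⁻ x∈ in case (x ∈? W) , (x ∈? W′) of λ where
        (yes x∈W , yes x∈W′) → ∪⁺ʳ (∪⁺ˡ (∩⁺ x∈W x∈W′))
        (yes x∈W , no x∉W′)  → ∪⁺ˡ (∩⁺ x∈W (∁∪⁺ x∉W′ (x∉L∪L′ ∘ ∪⁺ʳ)))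
        (no x∉W , yes x∈W′)  → ∪⁺ʳ (∪⁺ʳ (∩⁺ (∁∪⁺ x∉W (x∉L∪L′ ∘ ∪⁺ˡ)) x∈W′))
        (no x∉W , no x∉W′)   → contradiction x∈W∪W′ (∉∪⁺ x∉W x∉W′))
      (λ x∈ → case ∪⁻ x∈ of λ where
        (inj₁ x∈₂) → let x∈W , x∈R′ = ∩⁻ x∈₂ in
          ─⁺ (∪⁺ˡ x∈W) (∉∪⁺ (λ x∈L → disjoint W∣L x∈L x∈W) (proj₂ (∁∪⁻ x∈R′)))
        (inj₂ x∈′) → case ∪⁻ x∈′ of λ where
          (inj₁ x∈T) → let x∈W , x∈W′ = ∩⁻ x∈T in
            ─⁺ (∪⁺ˡ x∈W) (∉∪⁺ (λ x∈L → disjoint W∣L x∈L x∈W) (λ x∈L′ → disjoint W′∣L′ x∈L′ x∈W′))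
          (inj₂ x∈₃) → let x∈R , x∈W′ = ∩⁻ x∈₃ in
            ─⁺ (∪⁺ʳ x∈W′) (∉∪⁺ (proj₂ (∁∪⁻ x∈R)) (λ x∈L′ → disjoint W′∣L′ x∈L′ x∈W′)))

-- Adjacency and uncrossing for minimum cuts.

module MinimumCuts {n : ℕ} (G : Graph n) (κ : ℕ) (minimal : ∀ U → IsCut G U → κ ≤ ∣ U ∣) where
  open Graph G renaming (sym to edge-sym)
  open Encloses

  private
    variable
      v w y : Fin n
      D L L′ W W′ : Subset n

  -- If `w` had no neighbour in `L`, then `W - w` would still enclose `L`, separating it from `w`,
  -- and would be a cut with fewer than `κ` vertices.
  neighbour : Encloses G W L → ∣ W ∣ ≡ κ → x ∈ L → w ∈ W → ∃[ d ] d ∈ L × Edge d w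
  neighbour {W} {L} {x} {w} W∣L ∣W∣≡κ x∈L w∈W with any? (λ d → (d ∈? L) ×-dec edge? d w)
  ... | yes d = d
  ... | no none = contradiction (minimal (W - w) (encloses⇒cut G W-w∣L x∈L
      (λ w∈L → disjoint W∣L w∈L w∈W) λ w∈ → proj₂ (─⁻ w∈) (x∈⁅x⁆ w)))
      (ℕ.<⇒≱ (ℕ.<-≤-trans (x∈p⇒∣p-x∣<∣p∣ w∈W) (ℕ.≤-reflexive ∣W∣≡κ)))
    where
    W-w∣L : Encloses G (W - w) L
    W-w∣L .disjoint z∈L z∈ = disjoint W∣L z∈L (p─q⊆p W ⁅ w ⁆ z∈)
    W-w∣L .closed {z} {y} z∈L e y∉ with y ≟ w
    ... | yes refl = contradiction (z , z∈L , e) none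
    ... | no y≢w = closed W∣L z∈L e λ y∈W → y∉ (x∈p∧x≢y⇒x∈p-y y∈W y≢w)

  -- The witnesses `x` and `y` make `meet` and `join` cuts, so each has at least `κ` vertices;
  -- together they have at most `2κ`, which forces equality twice.
  uncross : Encloses G W L → Encloses G W′ L′ → ∣ W ∣ ≡ κ → ∣ W′ ∣ ≡ κ →
    x ∈ L → x ∈ L′ → y ∉ W → y ∉ L → y ∉ W′ → y ∉ L′ →
    IsκCut G κ (meet G L W L′ W′) × IsκCut G κ (join G L W L′ W′)
  uncross {W} {L} {W′} {L′} W∣L W′∣L′ ∣W∣≡κ ∣W′∣≡κ x∈L x∈L′ y∉W y∉L y∉W′ y∉L′ =
    (meet-cut , ℕ.≤-antisym
      (ℕ.+-cancelʳ-≤ κ _ _ (ℕ.≤-trans (ℕ.+-monoʳ-≤ ∣ M ∣ (minimal J join-cut)) sum≤)) (minimal M meet-cut)) ,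
    (join-cut , ℕ.≤-antisym
      (ℕ.+-cancelˡ-≤ κ _ _ (ℕ.≤-trans (ℕ.+-monoˡ-≤ ∣ J ∣ (minimal M meet-cut)) sum≤)) (minimal J join-cut))
    where
    M J : Subset n
    M = meet G L W L′ W′
    J = join G L W L′ W′
    y∉W∪W′ = ∉∪⁺ y∉W y∉W′
    meet-cut : IsCut G M
    meet-cut = encloses⇒cut G (encloses-meet G W∣L W′∣L′) (∩⁺ x∈L x∈L′) (y∉L ∘ proj₁ ∘ ∩⁻) (y∉W∪W′ ∘ proj₁ ∘ ∩⁻)
    join-cut : IsCut G J
    join-cut = encloses⇒cut G (encloses-join G W∣L W′∣L′) (∪⁺ˡ x∈L) (∉∪⁺ y∉L y∉L′) (y∉W∪W′ ∘ proj₁ ∘ ─⁻)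
    sum≤ : ∣ M ∣ + ∣ J ∣ ≤ κ + κ
    sum≤ = ℕ.≤-trans (∣meet∣+∣join∣≤ G L W L′ W′) (ℕ.≤-reflexive (cong₂ _+_ ∣W∣≡κ ∣W′∣≡κ))

  -- Minimum cuts inside `U ∪ A`, seen from a vertex `b` beyond `A`.

  module InsideSide (U A : Subset n) (U-cut : IsκCut G κ U) (A-side : IsSide G U A)
    (b : Fin n) (b∉U : b ∉ U) (b∉A : b ∉ A) where

    ∣U∣≡κ : ∣ U ∣ ≡ κ
    ∣U∣≡κ = proj₂ U-cut

    A∩U : x ∈ A → x ∉ U
    A∩U = disjoint (side⇒encloses G A-side)

    Inside : Subset n → Set
    Inside W = IsκCut G κ W × W ≢ U × W ⊆ U ∪ A

    outer∉ : W ⊆ U ∪ A → v ∉ U → v ∉ A → v ∉ W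
    outer∉ W⊆ v∉U v∉A v∈W = ∉∪⁺ v∉U v∉A (W⊆ v∈W)

    outer-sides : v ∉ U → v ∉ A → x ∈ component G U v → x ∉ U × x ∉ A
    outer-sides {v} v∉U v∉A x∈ =
      disjoint (side⇒encloses G (component-side G v∉U)) x∈ ,
      λ x∈A → v∉A (subst (v ∈_) (sides-≡ G (component-side G v∉U) A-side x∈ x∈A) (x∈component G U v))

    outer-neighbour : v ∉ U → w ∈ U → ∃[ d ] d ∈ component G U v × Edge d w
    outer-neighbour v∉U = neighbour (side⇒encloses G (component-side G v∉U)) ∣U∣≡κ (x∈component G U _)

    -- For W inside A, far W is S(W) and near W is R(W).
    far near : Subset n → Subset n
    far W = component G W b
    near W = ∁ (W ∪ far W)

    inside-missing : Inside W → ∃[ u ] u ∈ U × u ∉ W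
    inside-missing ((_ , ∣W∣≡κ) , W≢U , _) =
      ⊈-witness λ U⊆W → W≢U (sym (⊆∧∣∣≥⇒≡ U⊆W (ℕ.≤-reflexive (trans ∣W∣≡κ (sym ∣U∣≡κ)))))

    inside-meets-A : Inside W → ∃[ w ] w ∈ W × w ∈ A
    inside-meets-A ((_ , ∣W∣≡κ) , W≢U , W⊆) =
      let w , w∈W , w∉U = ⊈-witness λ W⊆U → W≢U (⊆∧∣∣≥⇒≡ W⊆U (ℕ.≤-reflexive (trans ∣U∣≡κ (sym ∣W∣≡κ))))
      in w , w∈W , [ ⊥-elim ∘ w∉U , id ]′ (∪⁻ (W⊆ w∈W))

    module _ (W-inside : Inside W) where

      private
        W-cut = proj₁ W-inside
        W⊆ : W ⊆ U ∪ A
        W⊆ = proj₂ (proj₂ W-inside)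

      b∉W : b ∉ W
      b∉W = outer∉ W⊆ b∉U b∉A

      b∈far : b ∈ far W
      b∈far = x∈component G W b

      far-side : IsSide G W (far W)
      far-side = component-side G b∉W

      far-encloses : Encloses G W (far W)
      far-encloses = side⇒encloses G far-side

      near-encloses : Encloses G W (near W)
      near-encloses = encloses-∁ G far-encloses

      outer-side⊆far : v ∉ U → v ∉ A → x ∈ component G U v → x ∈ far W → component G U v ⊆ far W
      outer-side⊆far v∉U v∉A = side-⊆-enclosed G (component-side G v∉U) far-encloses
        λ a∈ → let a∉U , a∉A = outer-sides v∉U v∉A a∈ in outer∉ W⊆ a∉U a∉A

      -- The side of `U` through `b` misses `W`, hence lies in `far W`, and every vertex of `U` has
      -- a neighbour in it.
      U─W⊆far : v ∈ U → v ∉ W → v ∈ far W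
      U─W⊆far v∈U v∉W = let d , d∈ , e = outer-neighbour b∉U v∈U in
        closed far-encloses (outer-side⊆far b∉U b∉A (x∈component G U b) b∈far d∈) e v∉W

      -- Some `u` in `U` is missed by `W` and so lies in `far W`; the side of `U` through `v` has a
      -- neighbour of `u` and misses `W`.
      outer⊆far : v ∉ U → v ∉ A → v ∈ far W
      outer⊆far v∉U v∉A =
        let u , u∈U , u∉W = inside-missing W-inside
            d , d∈ , e = outer-neighbour v∉U u∈U
            d∉U , d∉A = outer-sides v∉U v∉A d∈
            d∈far = closed far-encloses (U─W⊆far u∈U u∉W) (edge-sym e) (outer∉ W⊆ d∉U d∉A)
        in outer-side⊆far v∉U v∉A d∈ d∈far (x∈component G U _)

      far-isS : IsS G κ U A W (far W)
      far-isS = far-side , (λ v∈ → U─W⊆far (proj₁ (─⁻ v∈)) (proj₂ (─⁻ v∈))) ,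
        λ B B-side B≢A v∈B → outer⊆far (disjoint (side⇒encloses G B-side) v∈B)
          λ v∈A → B≢A (sides-≡ G B-side A-side v∈B v∈A)

      isS-unique : IsS G κ U A W D → D ≡ far W
      isS-unique (D-side , _ , outer⊆) = sides-≡ G D-side far-side
        (outer⊆ (component G U b) (component-side G b∉U)
          (λ eq → b∉A (subst (b ∈_) eq (x∈component G U b))) (x∈component G U b)) b∈far

      side⊆R : IsSide G W D → v ∈ D → v ∉ far W → x ∈ D → R G κ U A W x
      side⊆R D-side v∈D v∉far x∈D = far W , far-isS , _ , D-side , (λ { refl → v∉far v∈D }) , x∈D

      R⁺ : v ∈ near W → R G κ U A W v
      R⁺ v∈ = side⊆R (component-side G (proj₁ (∁∪⁻ v∈))) (x∈component G W _) (proj₂ (∁∪⁻ v∈)) (x∈component G W _)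

      R⁻ : R G κ U A W v → v ∈ near W
      R⁻ (S , S-isS , D , D-side , D≢S , v∈D) = ∁∪⁺ (disjoint (side⇒encloses G D-side) v∈D)
        λ v∈far → D≢S (trans (sides-≡ G D-side far-side v∈D v∈far) (sym (isS-unique S-isS)))

      near⊆A : v ∈ near W → v ∈ A
      near⊆A {v} v∈ with v ∈? U | v ∈? A
      ... | _ | yes v∈A = v∈A
      ... | yes v∈U | no _ = contradiction (U─W⊆far v∈U (proj₁ (∁∪⁻ v∈))) (proj₂ (∁∪⁻ v∈))
      ... | no v∉U | no v∉A = contradiction (outer⊆far v∉U v∉A) (proj₂ (∁∪⁻ v∈))

      b∉near : b ∉ near W
      b∉near = b∉A ∘ near⊆A

      near-nonempty : Nonempty (near W)
      near-nonempty = go (proj₁ W-cut)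
        where
        go : IsCut G W → Nonempty (near W)
        go (x , y , x∉W , y∉W , x≁y) with x ∈? far W | y ∈? far W
        ... | no x∉far | _ = x , ∁∪⁺ x∉W x∉far
        ... | _ | no y∉far = y , ∁∪⁺ y∉W y∉far
        ... | yes x∈far | yes y∈far = contradiction
          (x∉W , component⁻ G W x (subst (y ∈_)
            (sides-≡ G far-side (component-side G x∉W) x∈far (x∈component G W x)) y∈far)) x≁y

      -- The set `P` is `U ─ W`. It and everything beyond `A` lie in `far W`, so a path into `A`
      -- avoiding `W` would put a vertex of `A` into `far W`.
      A∩far-empty⇒matching : (∀ {v} → v ∈ A → v ∉ far W) → IsMatchingCut G κ U A W
      A∩far-empty⇒matching A∩far =
        let u , u∈U , u∉W = inside-missing W-inside in
        U ─ W , (u , ─⁺ u∈U u∉W) , record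
        { cut          = proj₁ U-cut
        ; side         = A-side
        ; P⊆U          = λ x∈ → proj₁ (─⁻ x∈)
        ; κ-cut        = W-cut
        ; U─P⊆W        = λ {x} x∈ → let x∈U , x∉P = ─⁻ x∈ in
            decidable-stable (x ∈? W) λ x∉W → x∉P (─⁺ x∈U x∉W)
        ; W⊆U∪A        = W⊆
        ; A─W-nonempty = let v , v∈ = near-nonempty in v , ─⁺ (near⊆A v∈) (proj₁ (∁∪⁻ v∈))
        ; disjointˡ    = λ (x , x∈) → let x∈O , x∈W = ∩⁻ x∈ in disjoint far-encloses (O⊆far x∈O) x∈W
        ; disjointʳ    = λ (x , x∈) → let x∈A─W , x∈W = ∩⁻ x∈ in proj₂ (─⁻ x∈A─W) x∈W
        ; separates    = λ x∈O y∈ (_ , path) →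
            A∩far (proj₁ (─⁻ y∈)) (encloses-Star G far-encloses (O⊆far x∈O) path)
        }
        where
        O⊆far : (U ─ W) ∪ ∁ (U ∪ A) ⊆ far W
        O⊆far x∈ = case ∪⁻ x∈ of λ where
          (inj₁ x∈U─W) → U─W⊆far (proj₁ (─⁻ x∈U─W)) (proj₂ (─⁻ x∈U─W))
          (inj₂ x∈∁)   → outer⊆far (proj₁ (∁∪⁻ x∈∁)) (proj₂ (∁∪⁻ x∈∁))

    -- Every vertex of `W` has a neighbour in `near W`, so it lies on the boundary of that region;
    -- outside `W′` it would fall into the common region itself.
    near-injective : Inside W → Inside W′ → near W ⊆ near W′ → near W′ ⊆ near W → W ≡ W′
    near-injective {W} {W′} W-in W′-in N⊆ N⊇ = ⊆∧∣∣≥⇒≡ W⊆W′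
      (ℕ.≤-reflexive (trans (proj₂ (proj₁ W′-in)) (sym (proj₂ (proj₁ W-in)))))
      where
      W⊆W′ : W ⊆ W′
      W⊆W′ {w} w∈W =
        let d , d∈ , e = neighbour (near-encloses W-in) (proj₂ (proj₁ W-in)) (proj₂ (near-nonempty W-in)) w∈W
        in decidable-stable (w ∈? W′) λ w∉W′ →
          disjoint (near-encloses W-in) (N⊇ (closed (near-encloses W′-in) (N⊆ d∈) e w∉W′)) w∈W

    𝓛⇒inside : 𝓛 G κ U A W → Inside W
    𝓛⇒inside (W-cut , W≢U , W⊆ , _) = W-cut , W≢U , W⊆

    𝓛? : Decidable (𝓛 G κ U A)
    𝓛? W = (cut? G W ×-dec (∣ W ∣ ℕ.≟ κ)) ×-dec ¬? (W ≟ˢ U) ×-dec (W ⊆? (U ∪ A)) ×-dec ¬? (small? G (κ ∸ 1) W)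

    -- One side `K` of `W` within `near W` lies, being connected, in a single side `E` of `W′`. As
    -- all of `W` is adjacent to `K`, it lies in `W′ ∪ E`.
    laminar : Inside W → Inside W′ → near W ⊆ near W′ →
      ∃[ D ] IsSide G W′ D × (∀ {v} → v ∈ D → R G κ U A W′ v) × IsLaminarCut G W′ D W
    laminar {W} {W′} W-in W′-in N⊆ = E , E-side , side⊆R W′-in E-side z∈E z∉far ,
      (E-side , proj₁ (proj₁ W-in) , W⊆W′∪E)
      where
      z = proj₁ (near-nonempty W-in)
      z∈ = proj₂ (near-nonempty W-in)
      z∉far = proj₂ (∁∪⁻ (N⊆ z∈))
      E K : Subset n
      E = component G W′ z
      K = component G W z
      z∈E = x∈component G W′ z
      E-side : IsSide G W′ E
      E-side = component-side G (proj₁ (∁∪⁻ (N⊆ z∈)))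
      K-side : IsSide G W K
      K-side = component-side G (proj₁ (∁∪⁻ z∈))
      K⊆near : K ⊆ near W
      K⊆near = side-⊆-enclosed G K-side (near-encloses W-in) (disjoint (side⇒encloses G K-side)) (x∈component G W z) z∈
      K⊆E : K ⊆ E
      K⊆E = side-⊆-enclosed G K-side (side⇒encloses G E-side)
        (λ a∈K → disjoint (near-encloses W′-in) (N⊆ (K⊆near a∈K))) (x∈component G W z) z∈E
      W⊆W′∪E : W ⊆ W′ ∪ E
      W⊆W′∪E {w} w∈W =
        let d , d∈K , e = neighbour (side⇒encloses G K-side) (proj₂ (proj₁ W-in)) (x∈component G W z) w∈W
        in case w ∈? W′ of λ where
          (yes w∈W′) → ∪⁺ˡ w∈W′
          (no w∉W′)  → ∪⁺ʳ (closed (side⇒encloses G E-side) (K⊆E d∈K) e w∉W′)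

    -- A cut that is not maximal is dominated by another one, whose `near` region is strictly larger
    -- by `near-injective`.
    below-maximal : 𝓛 G κ U A W → ∃[ Wᵢ ] (𝓛 G κ U A Wᵢ × near W ⊆ near Wᵢ) × IsMaximal G κ U A Wᵢ
    below-maximal {W} W∈𝓛 = saturate (∣_∣ ∘ near) n (∣p∣≤n ∘ near) step W (W∈𝓛 , id)
      where
      step : ∀ V → 𝓛 G κ U A V × near W ⊆ near V →
        IsMaximal G κ U A V ⊎ (∃[ V′ ] (𝓛 G κ U A V′ × near W ⊆ near V′) × ∣ near V ∣ < ∣ near V′ ∣)
      step V (V∈𝓛 , W⊆V) with anySubset? (λ V′ → 𝓛? V′ ×-dec ¬? (V′ ≟ˢ V) ×-dec (near V ⊆? near V′))
      ... | no none = inj₁ (V∈𝓛 , λ (V′ , V′∈𝓛 , V′≢V , R⊆) →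
        none (V′ , V′∈𝓛 , V′≢V , λ v∈ → R⁻ (𝓛⇒inside V′∈𝓛) (R⊆ (R⁺ (𝓛⇒inside V∈𝓛) v∈))))
      ... | yes (V′ , V′∈𝓛 , V′≢V , V⊆V′) = inj₂ (V′ , (V′∈𝓛 , V⊆V′ ∘ W⊆V) ,
        p⊂q⇒∣p∣<∣q∣ (V⊆V′ , ⊈-witness λ V′⊆V →
          V′≢V (sym (near-injective (𝓛⇒inside V∈𝓛) (𝓛⇒inside V′∈𝓛) V⊆V′ V′⊆V))))

    maximal-or-laminar : ∀ W → 𝓛 G κ U A W → IsMaximal G κ U A W
      ⊎ (∃[ Wᵢ ] IsMaximal G κ U A Wᵢ ×
          (∃[ D ] IsSide G Wᵢ D × (∀ {v} → v ∈ D → R G κ U A Wᵢ v) × IsLaminarCut G Wᵢ D W))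
    maximal-or-laminar W W∈𝓛 =
      let Wᵢ , (Wᵢ∈𝓛 , W⊆Wᵢ) , Wᵢ-max = below-maximal W∈𝓛
      -- For a maximal `W` the climb stops at `W`, which is laminar in any of its own sides, so the
      -- second alternative covers this case too.
      in inj₂ (Wᵢ , Wᵢ-max , laminar (𝓛⇒inside W∈𝓛) (𝓛⇒inside Wᵢ∈𝓛) W⊆Wᵢ)

    -- Overlapping regions `R(W)` and `R(W′)`.

    module Overlap (U-large : ¬ IsSmall G (κ ∸ 1) U) (U-unwheeled : ¬ IsWheelCut G κ U)
      (unmatched : ¬ (∃[ W ] IsMatchingCut G κ U A W))
      {W W′ : Subset n} (W∈𝓛 : 𝓛 G κ U A W) (W′∈𝓛 : 𝓛 G κ U A W′)
      {v : Fin n} (v∈N : v ∈ near W) (v∈N′ : v ∈ near W′) where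

      W-in = 𝓛⇒inside W∈𝓛
      W′-in = 𝓛⇒inside W′∈𝓛
      W∣N = near-encloses W-in
      W′∣N′ = near-encloses W′-in

      N N′ J : Subset n
      N = near W
      N′ = near W′
      J = join G N W N′ W′

      J∣N∪N′ : Encloses G J (N ∪ N′)
      J∣N∪N′ = encloses-join G W∣N W′∣N′

      J-cut : IsκCut G κ J
      J-cut = proj₂ (uncross W∣N W′∣N′ (proj₂ (proj₁ W-in)) (proj₂ (proj₁ W′-in)) v∈N v∈N′
        (b∉W W-in) (b∉near W-in) (b∉W W′-in) (b∉near W′-in))

      J⊆ : J ⊆ U ∪ A
      J⊆ x∈J = [ proj₂ (proj₂ W-in) , proj₂ (proj₂ W′-in) ]′ (∪⁻ (proj₁ (─⁻ x∈J)))

      -- Otherwise `A` would miss `far V′`, and `V′` would be a matching cut of `U`.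
      near⊈ : ∀ {V V′} → Inside V′ → A ⊆ near V ∪ near V′ → ∃[ x ] x ∈ near V × x ∉ V′ ∪ near V′
      near⊈ {V} {V′} in′ A⊆ = ⊈-witness λ N⊆ → unmatched (V′ , A∩far-empty⇒matching in′ λ a∈A a∈far →
        case ∪⁻ (A⊆ a∈A) of λ where
          (inj₁ a∈N)  → [ disjoint (far-encloses in′) a∈far , (λ a∈N′ → proj₂ (∁∪⁻ a∈N′) a∈far) ]′ (∪⁻ (N⊆ a∈N))
          (inj₂ a∈N′) → proj₂ (∁∪⁻ a∈N′) a∈far)

      -- Otherwise A = R(W) ∪ R(W′), and W and W′ cross in a 4-wheel of which U is a cut.
      J≢U : J ≢ U
      J≢U J≡U = U-unwheeled (4 , _ , _ , _ , wheel (proj₁ W-in) (proj₁ W′-in) spokes sectors ,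
        2F , 3F , (λ ()) , trans (sym J≡U) join≡)
        where
        open Grid G κ W N W′ N′ W∣N W′∣N′
        A⊆ : A ⊆ N ∪ N′
        A⊆ = side-⊆-enclosed G A-side J∣N∪N′ (λ a∈A a∈J → A∩U a∈A (subst (_ ∈_) J≡U a∈J))
          (near⊆A W-in v∈N) (∪⁺ˡ v∈N)
        U⊆J : U ⊆ J
        U⊆J = subst (_ ∈_) (sym J≡U)
        -- Spokes 0 and 1 use vertices of `W` and `W′` in `A`, which the two regions cover; spokes 2
        -- and 3 use vertices of `U = J` missed by `W′` and by `W`.
        spokes : ∀ i → Nonempty (cell (spoke i))
        spokes 0F = let w , w∈W , w∈A = inside-meets-A W-in in
          w , ∩⁺ w∈W ([ (λ w∈N → ⊥-elim (disjoint W∣N w∈N w∈W)) , id ]′ (∪⁻ (A⊆ w∈A)))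
        spokes 1F = let w , w∈W′ , w∈A = inside-meets-A W′-in in
          w , ∩⁺ ([ id , (λ w∈N′ → ⊥-elim (disjoint W′∣N′ w∈N′ w∈W′)) ]′ (∪⁻ (A⊆ w∈A))) w∈W′
        spokes 2F = let u , u∈U , u∉W′ = inside-missing W′-in ; u∈∪ , u∉ = ─⁻ (U⊆J u∈U) in
          u , ∩⁺ ([ id , ⊥-elim ∘ u∉W′ ]′ (∪⁻ u∈∪)) (∁∪⁺ u∉W′ (u∉ ∘ ∪⁺ʳ))
        spokes 3F = let u , u∈U , u∉W = inside-missing W-in ; u∈∪ , u∉ = ─⁻ (U⊆J u∈U) in
          u , ∩⁺ (∁∪⁺ u∉W (u∉ ∘ ∪⁺ˡ)) ([ ⊥-elim ∘ u∉W , id ]′ (∪⁻ u∈∪))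
        sectors : ∀ i → Nonempty (cell (sector i))
        sectors 0F = v , ∩⁺ v∈N v∈N′
        sectors 1F = let x , x∈N , x∉ = near⊈ {W} {W′} W′-in A⊆ in x , ∩⁺ x∈N (∁⁺ x∉)
        sectors 2F = b , ∩⁺ (∁∪⁺ (b∉W W-in) (b∉near W-in)) (∁∪⁺ (b∉W W′-in) (b∉near W′-in))
        sectors 3F = let x , x∈N′ , x∉ = near⊈ {W′} {W} W-in (λ a∈A → x∈p∪q⁺ ([ inj₂ , inj₁ ]′ (∪⁻ (A⊆ a∈A))))
          in x , ∩⁺ (∁⁺ x∉) x∈N′

      -- A side `D` of `J` lies inside or outside `N ∪ N′`. Inside, its complement contains all that
      -- is beyond `A`, so `U` would be small; outside, it contains `N`, so `W` would be small.
      J-large : ¬ IsSmall G (κ ∸ 1) J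
      J-large J-small = go (small⁻ G J-small)
        where
        go : ¬ HasSmallComplement G (κ ∸ 1) J
        go (D , D-side , ≤t) = case d ∈? (N ∪ N′) of λ where
            (yes d∈) → let D⊆ = side-⊆-enclosed G D-side J∣N∪N′ D#J d∈D d∈ in
              U-large (small⁺ G (A , A-side , ℕ.≤-trans (p⊆q⇒∣p∣≤∣q∣ {p = ∁ (U ∪ A)} {∁ (J ∪ D)} λ x∈ →
                let x∉U , x∉A = ∁∪⁻ x∈ in ∁∪⁺ (outer∉ J⊆ x∉U x∉A)
                  λ x∈D → x∉A ([ near⊆A W-in , near⊆A W′-in ]′ (∪⁻ (D⊆ x∈D)))) ≤t))
            (no d∉) → let D⊆ = side-⊆-enclosed G D-side (encloses-∁ G J∣N∪N′) D#J d∈D (∁∪⁺ (D#J d∈D) d∉) in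
              proj₂ (proj₂ (proj₂ W∈𝓛)) (small⁺ G (far W , far-side W-in ,
                ℕ.≤-trans (p⊆q⇒∣p∣≤∣q∣ {p = N} {∁ (J ∪ D)} λ x∈N →
                  ∁∪⁺ (disjoint J∣N∪N′ (∪⁺ˡ x∈N)) λ x∈D → proj₂ (∁∪⁻ (D⊆ x∈D)) (∪⁺ˡ x∈N)) ≤t))
          where
          D#J : ∀ {a} → a ∈ D → a ∉ J
          D#J = disjoint (side⇒encloses G D-side)
          d = proj₁ (side-nonempty G D-side)
          d∈D = proj₂ (side-nonempty G D-side)

      J∈𝓛 : 𝓛 G κ U A J
      J∈𝓛 = J-cut , J≢U , J⊆ , J-large

      N∪N′⊆near-J : N ∪ N′ ⊆ near J
      N∪N′⊆near-J x∈ = ∁∪⁺ (disjoint J∣N∪N′ x∈) λ x∈far → proj₂ (∁∪⁻ (far⊆ x∈far)) x∈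
        where
        J-in = 𝓛⇒inside J∈𝓛
        far⊆ : far J ⊆ ∁ (J ∪ (N ∪ N′))
        far⊆ = side-⊆-enclosed G (far-side J-in) (encloses-∁ G J∣N∪N′) (disjoint (far-encloses J-in))
          (b∈far J-in) (∁∪⁺ (b∉W J-in) (∉∪⁺ (b∉near W-in) (b∉near W′-in)))

    -- The join dominates both cuts, so maximality identifies it with each of them.
    maximal-disjoint : ¬ IsSmall G (κ ∸ 1) U → ¬ IsWheelCut G κ U → ¬ (∃[ W ] IsMatchingCut G κ U A W) →
      ∀ Wᵢ Wⱼ → IsMaximal G κ U A Wᵢ → IsMaximal G κ U A Wⱼ → Wᵢ ≢ Wⱼ →
      ∀ v → ¬ (R G κ U A Wᵢ v × R G κ U A Wⱼ v)
    maximal-disjoint U-large U-unwheeled unmatched Wᵢ Wⱼ (Wᵢ∈𝓛 , Wᵢ-max) (Wⱼ∈𝓛 , Wⱼ-max) Wᵢ≢Wⱼ v (v∈Rᵢ , v∈Rⱼ) =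
      Wᵢ≢Wⱼ (trans (sym (J≡ Wᵢ-max (λ x∈ → R⁺ J-in (N∪N′⊆near-J (∪⁺ˡ (R⁻ W-in x∈))))))
                   (J≡ Wⱼ-max (λ x∈ → R⁺ J-in (N∪N′⊆near-J (∪⁺ʳ (R⁻ W′-in x∈))))))
      where
      open Overlap U-large U-unwheeled unmatched Wᵢ∈𝓛 Wⱼ∈𝓛 (R⁻ (𝓛⇒inside Wᵢ∈𝓛) v∈Rᵢ) (R⁻ (𝓛⇒inside Wⱼ∈𝓛) v∈Rⱼ)
      J-in = 𝓛⇒inside J∈𝓛
      J≡ : ∀ {V} → ¬ (∃[ W′ ] 𝓛 G κ U A W′ × W′ ≢ V × (∀ {v} → R G κ U A V v → R G κ U A W′ v)) →
        (∀ {v} → R G κ U A V v → R G κ U A J v) → J ≡ V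
      J≡ {V} V-max R⊆ = decidable-stable (J ≟ˢ V) λ J≢V → V-max (J , J∈𝓛 , J≢V , R⊆)

    -- Matching cuts and the closure of `Θ` under unions.

    Matches : (P W : Subset n) → Set
    Matches = IsMatchingCutWrt G κ U A

    outer : Subset n → Subset n
    outer P = P ∪ ∁ (U ∪ A)

    b∈outer : ∀ {P} → b ∈ outer P
    b∈outer = ∪⁺ʳ (∁∪⁺ b∉U b∉A)

    outer∩A : ∀ {P} → P ⊆ U → x ∈ outer P → x ∉ A
    outer∩A P⊆U x∈ x∈A = [ (λ x∈P → A∩U x∈A (P⊆U x∈P)) , (λ x∈∁ → proj₂ (∁∪⁻ x∈∁) x∈A) ]′ (∪⁻ x∈)

    -- An edge leaving `outer P` ends in `U ─ P`, which is part of `W`, or in `A`, where separation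
    -- forces its end into `W`.
    matches⇒encloses : ∀ {P} → Matches P W → Encloses G W (outer P)
    matches⇒encloses {W} {P} match = record
      { disjoint = λ x∈O x∈W → M.disjointˡ (_ , ∩⁺ x∈O x∈W)
      ; closed   = λ {x} {y} x∈O e y∉W → case (y ∈? U) , (y ∈? A) of λ where
          (yes y∈U , _)       → ∪⁺ˡ (decidable-stable (y ∈? P) λ y∉P → y∉W (M.U─P⊆W (─⁺ y∈U y∉P)))
          (no _ , yes y∈A)    → contradiction ((λ x∈W → M.disjointˡ (x , ∩⁺ x∈O x∈W)) , (e , y∉W) ◅ ε)
                                  (M.separates x∈O (─⁺ y∈A y∉W))
          (no y∉U , no y∉A)   → ∪⁺ʳ (∁∪⁺ y∉U y∉A)
      }
      where module M = IsMatchingCutWrt match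

    encloses⇒matches : ∀ {P} → P ⊆ U → ∣ W ∣ ≡ κ → U ─ P ⊆ W → W ⊆ U ∪ A → Nonempty (A ─ W) →
      Encloses G W (outer P) → Matches P W
    encloses⇒matches P⊆U ∣W∣≡κ U─P⊆W W⊆ (a , a∈) W∣O = record
      { cut          = proj₁ U-cut
      ; side         = A-side
      ; P⊆U          = P⊆U
      ; κ-cut        = encloses⇒cut G W∣O b∈outer (λ a∈O → outer∩A P⊆U a∈O (proj₁ (─⁻ a∈))) (proj₂ (─⁻ a∈)) , ∣W∣≡κ
      ; U─P⊆W        = U─P⊆W
      ; W⊆U∪A        = W⊆
      ; A─W-nonempty = a , a∈
      ; disjointˡ    = λ (x , x∈) → let x∈O , x∈W = ∩⁻ x∈ in disjoint W∣O x∈O x∈W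
      ; disjointʳ    = λ (x , x∈) → let x∈A─W , x∈W = ∩⁻ x∈ in proj₂ (─⁻ x∈A─W) x∈W
      ; separates    = λ x∈O y∈ (_ , path) → outer∩A P⊆U (encloses-Star G W∣O x∈O path) (proj₁ (─⁻ y∈))
      }

    -- The condition on paths is traded for `Encloses`, which can be checked on edges.
    matches? : ∀ P W → Dec (Matches P W)
    matches? P W = map′ to from
      ((P ⊆? U) ×-dec (∣ W ∣ ℕ.≟ κ) ×-dec ((U ─ P) ⊆? W) ×-dec (W ⊆? (U ∪ A)) ×-dec nonempty? (A ─ W) ×-dec
        encloses? G W (outer P))
      where
      Conditions : Set
      Conditions = P ⊆ U × ∣ W ∣ ≡ κ × U ─ P ⊆ W × W ⊆ U ∪ A × Nonempty (A ─ W) × Encloses G W (outer P)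
      to : Conditions → Matches P W
      to (P⊆U , ∣W∣≡κ , U─P⊆W , W⊆ , A─W , W∣O) = encloses⇒matches P⊆U ∣W∣≡κ U─P⊆W W⊆ A─W W∣O
      from : Matches P W → Conditions
      from match = P⊆U , proj₂ κ-cut , U─P⊆W , W⊆U∪A , A─W-nonempty , matches⇒encloses match
        where open IsMatchingCutWrt match

    module Matching (A-big : 2 * κ < ∣ A ∣) where

      -- The outer regions are uncrossed with `b` inside both; a vertex `a` of `A` off both cuts is
      -- outside both. Their union is again an outer region, that of `P ∪ P′`.
      matches-∪ : ∀ {P P′} → Matches P W → Matches P′ W′ →
        Matches (P ∪ P′) (join G (outer P) W (outer P′) W′)
      matches-∪ {W} {W′} {P} {P′} match match′ =
        let a , a∈A , a∉ = ∣∣<⇒⊈ {q = W ∪ W′} {A} ∣W∪W′∣<∣A∣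
            W∣O = matches⇒encloses match
            W′∣O′ = matches⇒encloses match′
            _ , _ , ∣J∣≡κ = uncross W∣O W′∣O′ (proj₂ M.κ-cut) (proj₂ M′.κ-cut) b∈outer b∈outer
              (a∉ ∘ ∪⁺ˡ) (λ a∈O → outer∩A M.P⊆U a∈O a∈A) (a∉ ∘ ∪⁺ʳ) (λ a∈O → outer∩A M′.P⊆U a∈O a∈A)
        in encloses⇒matches ([ M.P⊆U , M′.P⊆U ]′ ∘ ∪⁻) ∣J∣≡κ U─⊆
          (λ x∈ → [ M.W⊆U∪A , M′.W⊆U∪A ]′ (∪⁻ (proj₁ (─⁻ x∈))))
          (a , ─⁺ a∈A (a∉ ∘ proj₁ ∘ ─⁻))
          (subst (Encloses G _) outer-∪ (encloses-join G W∣O W′∣O′))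
        where
        module M = IsMatchingCutWrt match
        module M′ = IsMatchingCutWrt match′
        ∣W∪W′∣<∣A∣ : ∣ W ∪ W′ ∣ < ∣ A ∣
        ∣W∪W′∣<∣A∣ = ℕ.≤-<-trans (∣p∪q∣≤∣p∣+∣q∣ W W′) (subst (_< ∣ A ∣)
          (cong₂ _+_ (sym (proj₂ M.κ-cut)) (trans (ℕ.+-identityʳ κ) (sym (proj₂ M′.κ-cut)))) A-big)
        outer-∪ : outer P ∪ outer P′ ≡ outer (P ∪ P′)
        outer-∪ = ⊆-antisym
          (λ x∈ → case ∪⁻ x∈ of λ where
            (inj₁ x∈O)  → [ ∪⁺ˡ ∘ ∪⁺ˡ , ∪⁺ʳ ]′ (∪⁻ x∈O)
            (inj₂ x∈O′) → [ ∪⁺ˡ ∘ ∪⁺ʳ , ∪⁺ʳ ]′ (∪⁻ x∈O′))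
          (λ x∈ → case ∪⁻ x∈ of λ where
            (inj₁ x∈P∪P′) → [ ∪⁺ˡ ∘ ∪⁺ˡ , ∪⁺ʳ ∘ ∪⁺ˡ ]′ (∪⁻ x∈P∪P′)
            (inj₂ x∈∁)    → ∪⁺ˡ (∪⁺ʳ x∈∁))
        U─⊆ : U ─ (P ∪ P′) ⊆ join G (outer P) W (outer P′) W′
        U─⊆ x∈ = let x∈U , x∉ = ─⁻ x∈ in ─⁺ (∪⁺ˡ (M.U─P⊆W (─⁺ x∈U (x∉ ∘ ∪⁺ˡ))))
          (∉∪⁺ (∉∪⁺ (x∉ ∘ ∪⁺ˡ) (λ x∈∁ → proj₁ (∁∪⁻ x∈∁) x∈U)) (∉∪⁺ (x∉ ∘ ∪⁺ʳ) (λ x∈∁ → proj₁ (∁∪⁻ x∈∁) x∈U)))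

      Matchable : Pred (Fin n) 0ℓ
      Matchable v = ∃[ P ] Θ G κ U A P × v ∈ P

      Θ? : Decidable (Θ G κ U A)
      Θ? P = (P ⊆? U) ×-dec anySubset? (matches? P)

      matchable? : Decidable Matchable
      matchable? v = anySubset? λ P → Θ? P ×-dec (v ∈? P)

      Q : Subset n
      Q = select matchable?

      -- `Θ` and `Θ*` have the same union: a vertex of a member of `Θ` lies in the intersection it
      -- generates, and each such intersection lies in a member of `Θ`.
      Q-⋃Θ* : Is⋃Θ* G κ U A Q
      Q-⋃Θ* v = mk⇔ to λ (I , (u , u∈U , (P , P∈Θ , u∈P) , spec) , v∈I) →
        ∈-select⁺ matchable? (P , P∈Θ , Equivalence.to (spec v) v∈I P P∈Θ u∈P)
        where
        to : v ∈ Q → ∃[ I ] Θ* G κ U A I × v ∈ I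
        to v∈Q with ∈-select⁻ matchable? v∈Q
        ... | P , P∈Θ@(P⊆U , _) , v∈P =
          I , (v , P⊆U v∈P , (P , P∈Θ , v∈P) , λ w → mk⇔ I⁻ I⁺) , I⁺ (λ _ _ v∈P′ → v∈P′)
          where
          avoids? = λ w → anySubset? λ P → Θ? P ×-dec (v ∈? P) ×-dec ¬? (w ∈? P)
          I = select (λ w → ¬? (avoids? w))
          I⁻ : ∀ {w} → w ∈ I → ∀ P → Θ G κ U A P → v ∈ P → w ∈ P
          I⁻ {w} w∈I P P∈Θ v∈P = decidable-stable (w ∈? P) λ w∉P →
            ∈-select⁻ (λ w → ¬? (avoids? w)) w∈I (P , P∈Θ , v∈P , w∉P)
          I⁺ : ∀ {w} → (∀ P → Θ G κ U A P → v ∈ P → w ∈ P) → w ∈ I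
          I⁺ all = ∈-select⁺ (λ w → ¬? (avoids? w)) λ (P , P∈Θ , v∈P , w∉P) → w∉P (all P P∈Θ v∈P)

      -- Starting from the given match, each vertex of `Q` in turn contributes a member of `Θ`
      -- containing it. The resulting `P` is itself in `Θ`, so it does not exceed `Q`.
      Q-matches : ∀ {P} → Matches P W → ∃[ X ] Matches Q X
      Q-matches {W} {P} match with cover (allFin n)
        where
        cover : (vs : List (Fin n)) → ∃[ P ] ∃[ W ] Matches P W × (∀ {v} → v List.∈ vs → v ∈ Q → v ∈ P)
        cover [] = P , W , match , λ ()
        cover (v ∷ vs) with cover vs | v ∈? Q
        ... | P , W , match , covers | no v∉Q = P , W , match , λ where
          (here refl) v∈Q → contradiction v∈Q v∉Q
          (there v∈vs)    → covers v∈vs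
        ... | P , W , match , covers | yes v∈Q =
          let P′ , (_ , W′ , match′) , v∈P′ = ∈-select⁻ matchable? v∈Q
          in P ∪ P′ , _ , matches-∪ match match′ , λ where
            (here refl) _    → ∪⁺ʳ v∈P′
            (there v∈vs) v∈Q → ∪⁺ˡ (covers v∈vs v∈Q)
      ... | P , W , match , covers = W , subst (λ P → Matches P W)
        (⊆-antisym (λ x∈P → ∈-select⁺ matchable? (P , (IsMatchingCutWrt.P⊆U match , W , match) , x∈P))
                   (λ x∈Q → covers (∈-allFin _) x∈Q)) match

    -- Cuts that cross `X`.

    module Crossing {Q X W : Subset n} (match : Matches Q X) (W∈𝓛 : 𝓛 G κ U A W)
      {q a : Fin n} (q∈Q : q ∈ Q) (q∈W : q ∈ W) (a∈A : a ∈ A) (a∈far : a ∈ far W) where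

      open IsMatchingCutWrt match using (W⊆U∪A) renaming (κ-cut to X-cut; P⊆U to Q⊆U)

      private
        W-in : Inside W
        W-in = 𝓛⇒inside W∈𝓛
        W-large : ¬ IsSmall G (κ ∸ 1) W
        W-large = proj₂ (proj₂ (proj₂ W∈𝓛))
        O S N : Subset n
        O = outer Q
        S = far W
        N = near W
        X∣O = matches⇒encloses match
        W∣S = far-encloses W-in
        W∣N = near-encloses W-in
        ∣X∣≡κ = proj₂ X-cut
        ∣W∣≡κ = proj₂ (proj₁ W-in)
        b∉X : b ∉ X
        b∉X = disjoint X∣O b∈outer

      -- `S(W)` is connected and contains both `b` in `O` and `a` in `A`; missing the boundary `X`,
      -- it could not leave `O`.
      S⊈O : (∀ {x} → x ∈ S → x ∉ X) → ⊥
      S⊈O S#X = outer∩A Q⊆U (side-⊆-enclosed G (far-side W-in) X∣O S#X (b∈far W-in) b∈outer a∈far) a∈A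

      X∩S : ∃[ s ] s ∈ X × s ∈ S
      X∩S with nonempty? (X ∩ S)
      ... | yes (s , s∈) = s , ∩⁻ s∈
      ... | no empty = ⊥-elim (S⊈O λ x∈S x∈X → empty (_ , ∩⁺ x∈X x∈S))

      -- Take a neighbour of `q` in `R(W)`: the edge leads from `O` into `A`, so it ends on `X`.
      X∩N : ∃[ m ] m ∈ X × m ∈ N
      X∩N =
        let d , d∈N , e = neighbour W∣N ∣W∣≡κ (proj₂ (near-nonempty W-in)) q∈W
        in d , decidable-stable (d ∈? X) (λ d∉X →
          outer∩A Q⊆U (closed X∣O (∪⁺ˡ q∈Q) (edge-sym e) d∉X) (near⊆A W-in d∈N)) , d∈N

      -- As W is not small, R(W) ⊆ X would force R(W) = X, so that S(W), which avoids R(W),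
      -- would lie in O.
      N⊈X∪O : ∃[ y ] y ∈ N × y ∉ X × y ∉ O
      N⊈X∪O =
        let y , y∈N , y∉X = ⊈-witness λ N⊆X →
              let N≡X = ⊆∧∣∣≥⇒≡ {p = N} {X} N⊆X (ℕ.≤-trans (ℕ.≤-reflexive ∣X∣≡κ) κ≤∣N∣)
              in S⊈O λ x∈S x∈X → proj₂ (∁∪⁻ (subst (_ ∈_) (sym N≡X) x∈X)) x∈S
        in y , y∈N , y∉X , λ y∈O → outer∩A Q⊆U y∈O (near⊆A W-in y∈N)
        where
        κ≤∣N∣ : κ ≤ ∣ N ∣
        κ≤∣N∣ = ℕ.≮⇒≥ λ ∣N∣<κ → W-large (small⁺ G (S , far-side W-in , ℕ.<⇒≤pred ∣N∣<κ))

      -- Every side of `U` other than `A` is adjacent to `q` and misses `X`, so all of them join the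
      -- component of `q`; each vertex of `Q` is adjacent to one of them.
      O-side : IsSide G X O
      O-side = subst (IsSide G X) (⊆-antisym K⊆O O⊆K) K-side
        where
        q∈O : q ∈ O
        q∈O = ∪⁺ˡ q∈Q
        K : Subset n
        K = component G X q
        K-side : IsSide G X K
        K-side = component-side G (disjoint X∣O q∈O)
        X∣K = side⇒encloses G K-side
        K⊆O : K ⊆ O
        K⊆O = side-⊆-enclosed G K-side X∣O (disjoint X∣K) (x∈component G X q) q∈O
        ∁⊆K : v ∉ U → v ∉ A → v ∈ K
        ∁⊆K v∉U v∉A =
          let d , d∈ , e = outer-neighbour v∉U (Q⊆U q∈Q)
              avoids = λ {x} x∈ → let x∉U , x∉A = outer-sides {x = x} v∉U v∉A x∈ in outer∉ W⊆U∪A x∉U x∉A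
          in side-⊆-enclosed G (component-side G v∉U) X∣K avoids d∈
            (closed X∣K (x∈component G X q) (edge-sym e) (avoids d∈)) (x∈component G U _)
        O⊆K : O ⊆ K
        O⊆K o∈O = case ∪⁻ o∈O of λ where
          (inj₁ o∈Q) → let d , d∈ , e = outer-neighbour b∉U (Q⊆U o∈Q)
                           d∉U , d∉A = outer-sides b∉U b∉A d∈
                       in closed X∣K (∁⊆K d∉U d∉A) e (disjoint X∣O o∈O)
          (inj₂ o∈∁) → ∁⊆K (proj₁ (∁∪⁻ o∈∁)) (proj₂ (∁∪⁻ o∈∁))

      -- Every side of X is adjacent to both X ∩ R(W) and X ∩ S(W).
      sides-meet-W : IsSide G X D → ∃[ w ] w ∈ W × w ∈ D
      sides-meet-W {D} D-side with nonempty? (W ∩ D)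
      ... | yes (w , w∈) = w , ∩⁻ w∈
      ... | no empty =
        let m , m∈X , m∈N = X∩N
            s , s∈X , s∈S = X∩S
            X∣D = side⇒encloses G D-side
            d , d∈D , e = neighbour X∣D ∣X∣≡κ (proj₂ (side-nonempty G D-side)) m∈X
            d′ , d′∈D , e′ = neighbour X∣D ∣X∣≡κ (proj₂ (side-nonempty G D-side)) s∈X
            D#W = λ {x} x∈D x∈W → empty (x , ∩⁺ x∈W x∈D)
            d∈N = closed W∣N m∈N (edge-sym e) (D#W d∈D)
            d′∈N = side-⊆-enclosed G D-side W∣N D#W d∈D d∈N d′∈D
        in contradiction s∈S (proj₂ (∁∪⁻ (closed W∣N d′∈N e′ (disjoint W∣S s∈S))))

      module Corners {t : Fin n} (t∈N : t ∈ N) (t∉X : t ∉ X) (t∉O : t ∉ O) where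

        private
          K P V : Subset n
          K = component G X t
          P = X ∩ N
          V = (X ─ P) ∪ (W ∩ O)
          t∈K = x∈component G X t
          K-side : IsSide G X K
          K-side = component-side G t∉X

        -- The vertex `t` of `R(W)` is the common exterior point for uncrossing `L` with `S(W)`.
        corner : ∀ {L} → Encloses G X L → b ∈ L → t ∉ L → IsκCut G κ (meet G L X S W)
        corner X∣L b∈L t∉L = proj₁ (uncross X∣L W∣S ∣X∣≡κ ∣W∣≡κ b∈L (b∈far W-in)
          t∉X t∉L (proj₁ (∁∪⁻ t∈N)) (proj₂ (∁∪⁻ t∈N)))

        O∩K : x ∈ O → x ∉ K
        O∩K x∈O x∈K = t∉O (subst (t ∈_) (sides-≡ G K-side O-side x∈K x∈O) t∈K)

        -- A third side of X would contain a vertex of W, making the corner at ∁ (X ∪ K)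
        -- strictly larger than the corner at O, although both are minimum cuts.
        two-sides : HasExactlyTwoSides G X O K
        two-sides = O-side , K-side , (λ O≡K → t∉O (subst (t ∈_) (sym O≡K) t∈K)) , exhaust
          where
          exhaust : ∀ D → IsSide G X D → D ≡ O ⊎ D ≡ K
          exhaust D D-side with D ≟ˢ O | D ≟ˢ K
          ... | yes D≡O | _ = inj₁ D≡O
          ... | no _ | yes D≡K = inj₂ D≡K
          ... | no D≢O | no D≢K =
            let w , w∈W , w∈D = sides-meet-W D-side
                w∉X = disjoint (side⇒encloses G D-side) w∈D
                w∉O = λ w∈O → D≢O (sides-≡ G D-side O-side w∈D w∈O)
                w∉K = λ w∈K → D≢K (sides-≡ G D-side K-side w∈D w∈K)
            in contradiction
              (p⊂q⇒∣p∣<∣q∣ {p = meet G O X S W} {meet G (∁ (X ∪ K)) X S W}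
                ( (λ x∈ → let x∈₁ , x∈₂₃ = ∩⁻ x∈ ; x∈₂ , x∈₃ = ∩⁻ x∈₂₃ in
                    ∩⁺ x∈₁ (∩⁺ ([ (λ x∈O → ∪⁺ˡ (∁∪⁺ (disjoint X∣O x∈O) (O∩K x∈O))) , ∪⁺ʳ ]′ (∪⁻ x∈₂)) x∈₃))
                , w , ∩⁺ (∪⁺ʳ w∈W) (∩⁺ (∪⁺ˡ (∁∪⁺ w∉X w∉K)) (∪⁺ʳ w∈W))
                , λ w∈ → ∉∪⁺ w∉O w∉X (proj₁ (∩⁻ (proj₂ (∩⁻ w∈))))))
              (ℕ.<-irrefl (trans (proj₂ (corner X∣O b∈outer t∉O))
                (sym (proj₂ (corner (encloses-∁ G (side⇒encloses G K-side)) (∁∪⁺ b∉X (O∩K b∈outer))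
                              (λ t∈ → proj₂ (∁∪⁻ t∈) t∈K))))))

        -- Removing `P` leaves the part of `X` in `S(W)` or on `W`. Thus `V` is the corner cut
        -- around `O ∩ S(W)`, which makes it a `κ`-cut.
        V≡meet : V ≡ meet G O X S W
        V≡meet = ⊆-antisym
          (λ {x} x∈ → case ∪⁻ x∈ of λ where
            (inj₁ x∈X─P) → let x∈X , x∉P = ─⁻ x∈X─P in
              ∩⁺ (∪⁺ˡ x∈X) (∩⁺ (∪⁺ʳ x∈X) (decidable-stable (x ∈? (S ∪ W)) λ x∉ →
                x∉P (∩⁺ x∈X (∁∪⁺ (x∉ ∘ ∪⁺ʳ) (x∉ ∘ ∪⁺ˡ)))))
            (inj₂ x∈W∩O) → let x∈W , x∈O = ∩⁻ x∈W∩O in ∩⁺ (∪⁺ʳ x∈W) (∩⁺ (∪⁺ˡ x∈O) (∪⁺ʳ x∈W)))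
          (λ {x} x∈ → let x∈X∪W , x∈₂₃ = ∩⁻ x∈ ; x∈O∪X , x∈S∪W = ∩⁻ x∈₂₃ in case x ∈? X of λ where
            (yes x∈X) → ∪⁺ˡ (─⁺ x∈X λ x∈P → let x∉W , x∉S = ∁∪⁻ (proj₂ (∩⁻ x∈P)) in ∉∪⁺ x∉S x∉W x∈S∪W)
            (no x∉X)  → ∪⁺ʳ (∩⁺ ([ ⊥-elim ∘ x∉X , id ]′ (∪⁻ x∈X∪W)) ([ id , ⊥-elim ∘ x∉X ]′ (∪⁻ x∈O∪X))))

        V∣O∩S : Encloses G V (O ∩ S)
        V∣O∩S = subst (λ V → Encloses G V (O ∩ S)) (sym V≡meet) (encloses-meet G X∣O W∣S)

        -- `R(W)` lies in `A`, hence off `O`, and `V` takes all of `W ∩ O`.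
        O─V⊆S : x ∈ O → x ∉ V → x ∈ S
        O─V⊆S {x} x∈O x∉V = decidable-stable (x ∈? S) λ x∉S →
          outer∩A Q⊆U x∈O (near⊆A W-in (∁∪⁺ (λ x∈W → x∉V (∪⁺ʳ (∩⁺ x∈W x∈O))) x∉S))

        V-matches : IsMatchingCutWrt G κ X O P V
        V-matches = record
          { cut          = proj₁ X-cut
          ; side         = O-side
          ; P⊆U          = λ x∈ → proj₁ (∩⁻ x∈)
          ; κ-cut        = subst (IsκCut G κ) (sym V≡meet) (corner X∣O b∈outer t∉O)
          ; U─P⊆W        = ∪⁺ˡ
          ; W⊆U∪A        = λ x∈ → [ ∪⁺ˡ ∘ proj₁ ∘ ─⁻ , ∪⁺ʳ ∘ proj₂ ∘ ∩⁻ ]′ (∪⁻ x∈)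
          ; A─W-nonempty = b , ─⁺ b∈outer (∉∪⁺ (b∉X ∘ proj₁ ∘ ─⁻) (b∉W W-in ∘ proj₁ ∘ ∩⁻))
          ; disjointˡ    = λ (x , x∈) → let x∈₁ , x∈V = ∩⁻ x∈ in case ∪⁻ x∈₁ of λ where
              (inj₁ x∈P) → [ (λ x∈X─P → proj₂ (─⁻ x∈X─P) x∈P)
                           , (λ x∈W∩O → disjoint X∣O (proj₂ (∩⁻ x∈W∩O)) (proj₁ (∩⁻ x∈P))) ]′ (∪⁻ x∈V)
              (inj₂ x∈∁) → [ proj₁ (∁∪⁻ x∈∁) ∘ proj₁ ∘ ─⁻ , proj₂ (∁∪⁻ x∈∁) ∘ proj₂ ∘ ∩⁻ ]′ (∪⁻ x∈V)
          ; disjointʳ    = λ (x , x∈) → let x∈O─V , x∈V = ∩⁻ x∈ in proj₂ (─⁻ x∈O─V) x∈V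
          -- The path is followed backwards: it starts at `z` in `O ∩ S`, which `V` encloses, so `x`
          -- would lie in `O`.
          ; separates    = λ x∈ z∈ (x∉V , path) →
              let z∈O , z∉V = ─⁻ z∈
                  x∈O , x∈S = ∩⁻ (encloses-Star G V∣O∩S (∩⁺ z∈O (O─V⊆S z∈O z∉V)) (reverse-path G x∉V path))
              in case ∪⁻ x∈ of λ where
                (inj₁ x∈P) → disjoint X∣O x∈O (proj₁ (∩⁻ x∈P))
                (inj₂ x∈∁) → proj₂ (∁∪⁻ x∈∁) x∈O
          }

        crossing : IsCrossingMatchingCut G κ X W
        crossing = O , K , P , record
          { cut        = proj₁ X-cut
          ; two-sides  = two-sides
          ; P-nonempty = let m , m∈X , m∈N = X∩N in m , ∩⁺ m∈X m∈N
          ; P⊆Y        = λ x∈ → proj₁ (∩⁻ x∈)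
          ; κ-cut      = proj₁ W-in
          ; W-meets-B′ = let w , w∈W , w∈K = sides-meet-W K-side in w , ∩⁺ w∈W w∈K
          ; matching   = V-matches
          }

    -- Two tests decide. If `W` misses `Q` it is laminar; if it meets `Q` but `S(W)` misses `A`, it
    -- is a matching cut; otherwise it crosses.
    trichotomy : ∀ {Q X} → Matches Q X → ∀ W → 𝓛 G κ U A W →
      let M = X ─ U ; Y = (U ─ Q) ∪ M in
      W ⊆ Y ∪ (A ─ M) ⊎ IsMatchingCut G κ U A W ⊎ IsCrossingMatchingCut G κ Y W
    trichotomy {Q} {X} match W W∈𝓛@(W-cut , W≢U , W⊆ , _) with nonempty? (W ∩ Q)
    ... | no W∩Q-empty = inj₁ λ {x} x∈W → case ∪⁻ (W⊆ x∈W) of λ where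
      (inj₁ x∈U) → ∪⁺ˡ (∪⁺ˡ (─⁺ x∈U λ x∈Q → W∩Q-empty (x , ∩⁺ x∈W x∈Q)))
      (inj₂ x∈A) → case x ∈? (X ─ U) of λ where
        (yes x∈M) → ∪⁺ˡ (∪⁺ʳ x∈M)
        (no x∉M)  → ∪⁺ʳ (─⁺ x∈A x∉M)
    ... | yes (q , q∈) with nonempty? (A ∩ far W)
    ...   | no A∩far-empty = inj₂ (inj₁ (A∩far-empty⇒matching (W-cut , W≢U , W⊆)
              λ x∈A x∈far → A∩far-empty (_ , ∩⁺ x∈A x∈far)))
    ...   | yes (a , a∈) = inj₂ (inj₂ (subst (λ Y → IsCrossingMatchingCut G κ Y W) X≡
              crossing))
      where
      open IsMatchingCutWrt match using (U─P⊆W; disjointˡ)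
      open Crossing match W∈𝓛 (proj₂ (∩⁻ q∈)) (proj₁ (∩⁻ q∈)) (proj₁ (∩⁻ a∈)) (proj₂ (∩⁻ a∈))
      crossing : IsCrossingMatchingCut G κ X W
      crossing = let t , t∈N , t∉X , t∉O = N⊈X∪O in Corners.crossing t∈N t∉X t∉O
      -- A matching cut for `Q` misses `Q` and contains `U ─ Q`, so this is exactly its part in `U`.
      X≡ : X ≡ (U ─ Q) ∪ (X ─ U)
      X≡ = ⊆-antisym
        (λ {x} x∈X → case x ∈? U of λ where
          (yes x∈U) → ∪⁺ˡ (─⁺ x∈U λ x∈Q → disjointˡ (x , ∩⁺ (∪⁺ˡ x∈Q) x∈X))
          (no x∉U)  → ∪⁺ʳ (─⁺ x∈X x∉U))
        (λ x∈ → [ U─P⊆W , proj₁ ∘ ─⁻ ]′ (∪⁻ x∈))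

-- Two vertices separated by `U` cannot both lie in `A`; this supplies the vertex `b`.
outside-of-side : ∀ {n} (G : Graph n) {U A} → IsCut G U → IsSide G U A → ∃[ b ] b ∉ U × b ∉ A
outside-of-side G {U} {A} (x , y , x∉U , y∉U , x≁y) A-side with x ∈? A | y ∈? A
... | no x∉A | _      = x , x∉U , x∉A
... | _      | no y∉A = y , y∉U , y∉A
... | yes x∈A | yes y∈A = contradiction
  (x∉U , component⁻ G U x (subst (y ∈_)
    (sides-≡ G A-side (component-side G x∉U) x∈A (x∈component G U x)) y∈A)) x≁y

theorem5 : ∀ {n : ℕ} (G : Graph n) (κ : ℕ) →
    Connected G → NonComplete G → IsVertexConnectivity G κ → 4 * κ < n →
    ∀ (U A : Subset n) →
    IsκCut G κ U → ¬ IsSmall G (κ ∸ 1) U → ¬ IsWheelCut G κ U →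
    IsSide G U A → 2 * κ < ∣ A ∣ →
    ((∃[ W ] IsMatchingCut G κ U A W) →
    ∃[ Q ] Is⋃Θ* G κ U A Q ×
    (∃[ M ] IsMatch G κ U A Q M) ×
    (∀ M → IsMatch G κ U A Q M →
    let X = (U ─ Q) ∪ M in
    ∀ W → 𝓛 G κ U A W →
    W ⊆ X ∪ (A ─ M)
    ⊎ IsMatchingCut G κ U A W
    ⊎ IsCrossingMatchingCut G κ X W))
    ×
    (¬ (∃[ W ] IsMatchingCut G κ U A W) →
    (∀ W → 𝓛 G κ U A W →
    IsMaximal G κ U A W
    ⊎ (∃[ Wᵢ ] IsMaximal G κ U A Wᵢ ×
    (∃[ D ] IsSide G Wᵢ D × (∀ {v} → v ∈ D → R G κ U A Wᵢ v) × IsLaminarCut G Wᵢ D W)))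
    × (∀ Wᵢ Wⱼ → IsMaximal G κ U A Wᵢ → IsMaximal G κ U A Wⱼ → Wᵢ ≢ Wⱼ →
    ∀ v → ¬ (R G κ U A Wᵢ v × R G κ U A Wⱼ v)))
theorem5 G κ _ _ (_ , minimal) _ U A U-cut U-large U-unwheeled A-side A-big =
  (λ (W , P , _ , match) → let X , X-matches = Q-matches match in
    -- A given `M` may come from a matching cut `Y` other than `X`, so `trichotomy` is applied to
    -- `Y`.
    Q , Q-⋃Θ* , (X ─ U , X , X-matches , refl) , λ { _ (Y , Y-matches , refl) → trichotomy Y-matches }) ,
  λ unmatched → maximal-or-laminar , maximal-disjoint U-large U-unwheeled unmatched
  where
  b = outside-of-side G (proj₁ U-cut) A-side
  open MinimumCuts G κ minimal
  open InsideSide U A U-cut A-side (proj₁ b) (proj₁ (proj₂ b)) (proj₂ (proj₂ b))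
  open Matching A-big
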